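{- Let $S\subset\mathbb{R}^2$ be a finite set of points in general position and let $a,b,c\in S$ be distinct. Then $ab$ is an exit edge of $S$ with witness $c$ if and only if the dual lines $a^*,b^*,c^*$ bound a triangular cell $\Delta$ of the arrangement $\mathcal{A}$ of the lines $S^*=\{s^*:s\in S\}$ in the projective plane such that $\Delta$ is not the marked cell, $c^*$ is the witness line of $\Delta$, and the point $a^*\cap b^*$ is the exit vertex of $\Delta$.
   Context: General position: no three points collinear. For distinct $a,b,c\in S$, $ab$ is an exit edge with witness $c$ if there is no $p\in S$ such that the line through $a$ and $p$ strictly separates $b$ from $c$, and no $p\in S$ such that the line through $b$ and $p$ strictly separates $a$ from $c$. Duality: a point $p=(p_x,p_y)$ is mapped to the line $p^*: y=p_x x-p_y$, regarded as a line in the real projective plane $\mathbb{P}^2$ (the Euclidean plane plus a line at infinity); $\mathcal{A}$ is the arrangement of the lines $S^*$ in $\mathbb{P}^2$, and its cells are the closures of the connected components of $\mathbb{P}^2$ minus the lines. The marked cell is the cell of $\mathcal{A}$ containing the point at infinity in the vertical direction. Each line $s^*$ is oriented in the direction of increasing $x$, and each side of a cell inherits this orientation. For a triangular cell $\Delta$ other than the marked cell, the oriented sides do not form a directed cycle, so exactly one vertex of $\Delta$ has one incident side directed into it and the other directed out of it; this vertex is the exit vertex of $\Delta$, and the line containing the side of $\Delta$ opposite to it is the witness line of $\Delta$. -}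

module Defs where

open import Algebra.Bundles using (CommutativeRing)
open import Data.Fin using (Fin)
open import Data.Fin.Patterns using (0F; 1F; 2F)
open import Data.List using (List)
open import Data.Product using (Σ-syntax; ∃; ∃-syntax; _×_; _,_; proj₁; proj₂)
open import Data.Product.Relation.Binary.Pointwise.NonDependent using (×-setoid)
open import Data.Sum using (_⊎_)
open import Level using (0ℓ; suc)
open import Relation.Binary.Bundles using (Setoid)
open import Relation.Binary.Core using (Rel)
open import Relation.Binary.Definitions using (_Respects_)
open import Relation.Binary.PropositionalEquality using (_≢_)
open import Relation.Binary.Structures using (IsStrictTotalOrder)
open import Relation.Nullary using (¬_)
open import Relation.Unary
  using (Pred; _∈_; _∉_; _⊆_; _∪_; _∩_; _≐_; _≬_; _⊥_; Satisfiable)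
import Data.List.Membership.Setoid as Membership

-- The axioms of a Dedekind-complete ordered field, which determine the
-- classical field ℝ up to isomorphism.  The standard library has no real
-- numbers, so the geometry below is developed over any such field.
record RealField : Set (suc 0ℓ) where
  infix 4 _<_ _≤_ _≉_
  field
    commutativeRing : CommutativeRing 0ℓ 0ℓ
  open CommutativeRing commutativeRing public
    hiding (_≉_)
    renaming (Carrier to ℝ; setoid to ℝ-setoid)

  _≉_ : Rel ℝ 0ℓ
  x ≉ y = ¬ (x ≈ y)

  field
    0≉1                : 0# ≉ 1#
    inverse            : ∀ x → x ≉ 0# → ∃[ y ] x * y ≈ 1#
    _<_                : Rel ℝ 0ℓ
    isStrictTotalOrder : IsStrictTotalOrder _≈_ _<_
    +-monoˡ-<          : ∀ z {x y} → x < y → x + z < y + z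
    *-pos              : ∀ {x y} → 0# < x → 0# < y → 0# < x * y

  _≤_ : Rel ℝ 0ℓ
  x ≤ y = x < y ⊎ x ≈ y

  UpperBound : Pred ℝ 0ℓ → Pred ℝ 0ℓ
  UpperBound A b = ∀ x → x ∈ A → x ≤ b

  field
    supremum : ∀ (A : Pred ℝ 0ℓ) → Satisfiable A → Satisfiable (UpperBound A) →
               ∃[ s ] s ∈ UpperBound A × (∀ b → b ∈ UpperBound A → s ≤ b)

module Geometry (R : RealField) where
  open RealField R

  ------------------------------------------------------------------------
  -- The Euclidean plane

  ℝ²-setoid : Setoid 0ℓ 0ℓ
  ℝ²-setoid = ×-setoid ℝ-setoid ℝ-setoid

  open Setoid ℝ²-setoid public using () renaming (Carrier to ℝ²; _≈_ to _≈²_)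
  open Membership ℝ²-setoid public using () renaming (_∈_ to _∈ˢ_)

  infix 4 _≉²_
  _≉²_ : Rel ℝ² 0ℓ
  p ≉² q = ¬ (p ≈² q)

  -- The line αx + βy + γ = 0.
  record Line : Set where
    constructor line
    field
      α β γ         : ℝ
      nondegenerate : ¬ (α ≈ 0# × β ≈ 0#)

    eval : ℝ² → ℝ
    eval (x , y) = α * x + β * y + γ

    Through : Pred ℝ² 0ℓ
    Through p = eval p ≈ 0#

    StrictlySeparates : ℝ² → ℝ² → Set
    StrictlySeparates p q = (eval p < 0# × 0# < eval q) ⊎ (eval q < 0# × 0# < eval p)

  open Line public using (Through; StrictlySeparates)

  Collinear : ℝ² → ℝ² → ℝ² → Set
  Collinear p q r = ∃[ ℓ ] Through ℓ p × Through ℓ q × Through ℓ r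

  -- A list represents the finite set of its members; repetitions are harmless.
  GeneralPosition : List ℝ² → Set
  GeneralPosition S = ∀ {p q r} → p ∈ˢ S → q ∈ˢ S → r ∈ˢ S →
    p ≉² q → q ≉² r → p ≉² r → ¬ Collinear p q r

  -- The line through p and q strictly separates r from s.  There is no
  -- "line through p and q" when p = q.
  LineSeparates : ℝ² → ℝ² → ℝ² → ℝ² → Set
  LineSeparates p q r s =
    p ≉² q × ∃[ ℓ ] Through ℓ p × Through ℓ q × StrictlySeparates ℓ r s

  ExitEdge : List ℝ² → ℝ² → ℝ² → ℝ² → Set
  ExitEdge S a b c =
    (¬ (∃[ p ] p ∈ˢ S × LineSeparates a p b c)) ×
    (¬ (∃[ p ] p ∈ˢ S × LineSeparates b p a c))

  ------------------------------------------------------------------------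
  -- The real projective plane

  -- Homogeneous coordinates (x , y , w): the Euclidean point (x , y) is
  -- [x : y : 1], and w = 0 is the line at infinity.
  ℝ³-setoid : Setoid 0ℓ 0ℓ
  ℝ³-setoid = ×-setoid ℝ-setoid (×-setoid ℝ-setoid ℝ-setoid)

  open Setoid ℝ³-setoid public using () renaming (Carrier to ℝ³; _≈_ to _≈³_)

  0³ : ℝ³
  0³ = 0# , 0# , 0#

  infixl 6 _+³_
  _+³_ : ℝ³ → ℝ³ → ℝ³
  (x , y , w) +³ (x′ , y′ , w′) = x + x′ , y + y′ , w + w′

  infixr 7 _·³_
  _·³_ : ℝ → ℝ³ → ℝ³
  k ·³ (x , y , w) = k * x , k * y , k * w

  infix 4 _∼_
  _∼_ : Rel ℝ³ 0ℓ
  u ∼ v = ∃[ k ] k ≉ 0# × u ≈³ k ·³ v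

  record ℙ² : Set where
    constructor [_,_]
    field
      rep     : ℝ³
      nonzero : ¬ (rep ≈³ 0³)

  open ℙ² public

  -- Subsets of the projective plane are predicates on ℙ² respecting _≈ᴾ_.
  infix 4 _≈ᴾ_
  _≈ᴾ_ : Rel ℙ² 0ℓ
  p ≈ᴾ q = rep p ∼ rep q

  affine : ℝ² → ℝ³
  affine (x , y) = x , y , 1#

  verticalInfinity : ℙ²
  verticalInfinity = [ (0# , 1# , 0#) , (λ (_ , 1≈0 , _) → 0≉1 (sym 1≈0)) ]

  Near : ℝ → ℝ³ → ℝ³ → Set
  Near ε (x , y , w) (x′ , y′ , w′) = close x x′ × close y y′ × close w w′
    where
    close : ℝ → ℝ → Set
    close s t = s < t + ε × t < s + ε

  -- The quotient topology induced from ℝ³ ∖ {0}.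
  record Open (U : Pred ℙ² 0ℓ) : Set where
    field
      respects : U Respects _≈ᴾ_
      interior : ∀ p → p ∈ U →
        ∃[ ε ] 0# < ε × (∀ q → Near ε (rep p) (rep q) → q ∈ U)

  Closure : Pred ℙ² 0ℓ → Pred ℙ² (suc 0ℓ)
  Closure A p = ∀ (U : Pred ℙ² 0ℓ) → Open U → p ∈ U → U ≬ A

  Connected : Pred ℙ² 0ℓ → Set (suc 0ℓ)
  Connected C = ∀ (U V : Pred ℙ² 0ℓ) → Open U → Open V →
    C ⊆ U ∪ V → C ∩ U ⊥ C ∩ V → ¬ (C ≬ U × C ≬ V)

  record IsConnectedComponent (X K : Pred ℙ² 0ℓ) : Set (suc 0ℓ) where
    field
      respects  : K Respects _≈ᴾ_
      nonempty  : Satisfiable K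
      included  : K ⊆ X
      connected : Connected K
      maximal   : ∀ (C : Pred ℙ² 0ℓ) → C Respects _≈ᴾ_ → Connected C →
                  C ⊆ X → K ⊆ C → C ⊆ K

  ------------------------------------------------------------------------
  -- The dual arrangement

  -- The line y = pₓ x − p_y together with its point at infinity.
  infix 9 _⋆
  _⋆ : ℝ² → Pred ℙ² 0ℓ
  ((px , py) ⋆) [ (x , y , w) , _ ] = y ≈ px * x - py * w

  Complement : List ℝ² → Pred ℙ² 0ℓ
  Complement S q = ∀ s → s ∈ˢ S → q ∉ s ⋆

  IsCell : List ℝ² → Pred ℙ² 0ℓ → Set (suc 0ℓ)
  IsCell S F = ∃[ K ] IsConnectedComponent (Complement S) K × F ≐ Closure K

  IsMarkedCell : List ℝ² → Pred ℙ² 0ℓ → Set (suc 0ℓ)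
  IsMarkedCell S F = IsCell S F × verticalInfinity ∈ F

  ------------------------------------------------------------------------
  -- Projective triangles

  combination : (Fin 3 → ℝ) → (Fin 3 → ℝ³) → ℝ³
  combination c v = c 0F ·³ v 0F +³ c 1F ·³ v 1F +³ c 2F ·³ v 2F

  -- Three non-collinear points span four closed triangles in the projective
  -- plane; the signs of the chosen representatives single out one of them.
  record Triangle : Set where
    field
      vertex : Fin 3 → ℙ²

    corner : Fin 3 → ℝ³
    corner i = rep (vertex i)

    field
      independent : ∀ c → combination c corner ≈³ 0³ → ∀ i → c i ≈ 0#

    region : Pred ℙ² 0ℓ
    region p = ∃[ c ] (∀ i → 0# ≤ c i) × rep p ∼ combination c corner

    sideOpposite : Fin 3 → Pred ℙ² 0ℓ
    sideOpposite i p =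
      ∃[ c ] (∀ j → 0# ≤ c j) × c i ≈ 0# × rep p ∼ combination c corner

  open Triangle public using (vertex; corner; region; sideOpposite)

  record IsBoundedBy (Δ : Triangle) (ℓ₁ ℓ₂ ℓ₃ : Pred ℙ² 0ℓ) : Set where
    field
      side₁ : ∃[ i ] sideOpposite Δ i ⊆ ℓ₁
      side₂ : ∃[ i ] sideOpposite Δ i ⊆ ℓ₂
      side₃ : ∃[ i ] sideOpposite Δ i ⊆ ℓ₃
      sides : ∀ i → sideOpposite Δ i ⊆ ℓ₁ ⊎ sideOpposite Δ i ⊆ ℓ₂ ⊎ sideOpposite Δ i ⊆ ℓ₃

  segment : ℝ³ → ℝ³ → ℝ → ℝ³
  segment u v t = (1# - t) ·³ u +³ t ·³ v

  -- The side {segment u v t : 0 ≤ t ≤ 1} is directed from u to v: travelling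
  -- from u to v, the Euclidean x-coordinate increases.  A side may cross the
  -- line at infinity, where x jumps from +∞ to −∞, so x is compared only along
  -- stretches of the side that lie in the Euclidean plane.
  Directed : ℝ³ → ℝ³ → Set
  Directed u v = ∀ {s t} → 0# ≤ s → s < t → t ≤ 1# →
    (∀ r → s ≤ r → r ≤ t → ∃[ z ] segment u v r ∼ affine z) →
    ∀ {p q} → segment u v s ∼ affine p → segment u v t ∼ affine q →
    proj₁ p < proj₁ q

  IsExitVertex : Triangle → Fin 3 → Set
  IsExitVertex Δ i = ∃[ j ] ∃[ k ] i ≢ j × i ≢ k × j ≢ k ×
    Directed (corner Δ j) (corner Δ i) × Directed (corner Δ i) (corner Δ k)

  IsWitnessLine : Triangle → Pred ℙ² 0ℓ → Set
  IsWitnessLine Δ ℓ = ∃[ i ] IsExitVertex Δ i × sideOpposite Δ i ⊆ ℓ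

  IsExitPoint : Triangle → Pred ℙ² 0ℓ → Set
  IsExitPoint Δ A = ∃[ i ] IsExitVertex Δ i × A ≐ (_≈ᴾ vertex Δ i)

{-# OPTIONS --safe #-}
-- Write L_p(x, y, w) = y - pₓ x + p_y w for the linear form of the dual line of p,
-- and D, A, B, C for the orientations of abc, pbc, apc, abp.  Then Cramer's rule
-- reads D L_p = A L_a + B L_b + C L_c, and the line through a and p (through b
-- and p) separates b from c (a from c) exactly if BC > 0 (AC > 0).
--
-- If neither happens for any p in S, then no L_p vanishes on the open cone where
-- L_a and L_b have one sign and L_c has the other.  This cone is therefore a
-- connected component of the complement, and its closure is a triangle.
-- It is not marked, because all forms take the value 1 at the vertical point at
-- infinity, and the orientation of its sides is read off cross products of its
-- corners.  Conversely, let u → v → w be the corners of an unmarked triangular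
-- cell, v being its exit vertex.  Then u × v and v × w are positive multiples of
-- the forms of the two sides meeting at v, while w × u is a negative multiple of
-- the third form, since the vertical point would be in the cell otherwise.  So
-- L_a L_c and L_b L_c are negative in the interior.  If BC > 0, the line of p
-- would have different signs, relative to L_c, near two corners and thus cross the
-- cell; likewise for AC > 0.

module Submission where

open import Algebra.Bundles using (CommutativeRing)
import Algebra.Properties.AbelianGroup
import Algebra.Properties.Ring
import Algebra.Properties.Semiring.Mult.TCOptimised
import Algebra.Solver.Ring
open import Algebra.Solver.Ring.AlmostCommutativeRing
  using (fromCommutativeRing; _-Raw-AlmostCommutative⟶_)
open import Data.Fin using (Fin)
open import Data.Fin.Patterns using (0F; 1F; 2F)
import Data.Fin.Properties as Fin
open import Data.Integer as ℤ using (ℤ; +_; -[1+_]; _⊖_; _◃_)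
import Data.Integer.Properties as ℤ
open import Data.List using (List)
open import Data.Maybe using (Maybe; just; nothing)
open import Data.Nat as ℕ using (zero; suc)
import Data.Nat.Properties as ℕ
open import Data.Product using (∃-syntax; _×_; _,_; proj₁; proj₂)
import Data.Sign as ±
open import Data.Sum using (_⊎_; inj₁; inj₂; [_,_]′)
open import Defs
open import Function using (case_of_)
open import Function.Bundles using (_⇔_; mk⇔)
open import Level using (0ℓ)
open import Relation.Binary.Bundles using (Setoid)
open import Relation.Binary.Definitions using (tri<; tri≈; tri>)
open import Relation.Binary.PropositionalEquality as ≡ using (_≡_; _≢_)
import Relation.Binary.Reasoning.Setoid
open import Relation.Binary.Structures using (IsStrictTotalOrder)
open import Relation.Nullary using (¬_; Dec; yes; no; contradiction)
open import Relation.Nullary.Decidable using (_⊎-dec_; toWitness)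
open import Relation.Unary using (Pred; Satisfiable; _∈_; _⊆_; _∪_; _∩_; _⊥_)

-- A ring solver with integer coefficients.

module ℤ-Coefficients (R : CommutativeRing 0ℓ 0ℓ) where
  open CommutativeRing R
  open Algebra.Properties.Ring ring
  open Algebra.Properties.AbelianGroup +-abelianGroup using (⁻¹-∙-comm)
  open Algebra.Properties.Semiring.Mult.TCOptimised semiring renaming (_×_ to infixl 8 _·_)
  open Relation.Binary.Reasoning.Setoid setoid

  -- Integers are the solver's coefficients because their equality is decidable. The optimised
  -- multiple makes `1 · 1#` reduce to `1#`, so the constants 0 and 1 of a solved identity are
  -- definitionally `0#` and `1#`.
  ⟦_⟧ᶻ : ℤ → Carrier
  ⟦ + n      ⟧ᶻ = n · 1#
  ⟦ -[1+ n ] ⟧ᶻ = - (suc n · 1#)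

  neg-homo : ∀ i → ⟦ ℤ.- i ⟧ᶻ ≈ - ⟦ i ⟧ᶻ
  neg-homo (+ zero)  = sym -0#≈0#
  neg-homo (+ suc n) = refl
  neg-homo -[1+ n ]  = sym (-‿involutive _)

  ⊖-homo : ∀ m n → ⟦ m ⊖ n ⟧ᶻ ≈ m · 1# - n · 1#
  ⊖-homo m zero = begin
    m · 1#        ≈⟨ +-identityʳ _ ⟨
    m · 1# + 0#   ≈⟨ +-congˡ -0#≈0# ⟨
    m · 1# - 0#   ∎
  ⊖-homo zero (suc n) = sym (+-identityˡ _)
  ⊖-homo (suc m) (suc n) = begin
    ⟦ suc m ⊖ suc n ⟧ᶻ              ≡⟨ ≡.cong ⟦_⟧ᶻ (ℤ.[1+m]⊖[1+n]≡m⊖n m n) ⟩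
    ⟦ m ⊖ n ⟧ᶻ                      ≈⟨ ⊖-homo m n ⟩
    x - y                           ≈⟨ +-congʳ (+-identityˡ _) ⟨
    0# + x - y                      ≈⟨ +-congʳ (+-congʳ (-‿inverseʳ 1#)) ⟨
    1# - 1# + x - y                 ≈⟨ +-congʳ (+-assoc _ _ _) ⟩
    1# + (- 1# + x) - y             ≈⟨ +-congʳ (+-congˡ (+-comm _ _)) ⟩
    1# + (x - 1#) - y               ≈⟨ +-congʳ (+-assoc _ _ _) ⟨
    1# + x - 1# - y                 ≈⟨ +-assoc _ _ _ ⟩
    1# + x + (- 1# - y)             ≈⟨ +-congˡ (⁻¹-∙-comm _ _) ⟩
    1# + x - (1# + y)               ≈⟨ +-cong (1+× m 1#) (-‿cong (1+× n 1#)) ⟨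
    suc m · 1# - suc n · 1#         ∎
    where
    x = m · 1#
    y = n · 1#

  +-homo : ∀ i j → ⟦ i ℤ.+ j ⟧ᶻ ≈ ⟦ i ⟧ᶻ + ⟦ j ⟧ᶻ
  +-homo (+ m)    (+ n)    = ×-homo-+ 1# m n
  +-homo (+ m)    -[1+ n ] = ⊖-homo m (suc n)
  +-homo -[1+ m ] (+ n)    = trans (⊖-homo n (suc m)) (+-comm _ _)
  +-homo -[1+ m ] -[1+ n ] = begin
    - (suc (suc (m ℕ.+ n)) · 1#)         ≡⟨ ≡.cong (λ k → - (suc k · 1#)) (ℕ.+-suc m n) ⟨
    - ((suc m ℕ.+ suc n) · 1#)           ≈⟨ -‿cong (×-homo-+ 1# (suc m) (suc n)) ⟩
    - (suc m · 1# + suc n · 1#)          ≈⟨ ⁻¹-∙-comm _ _ ⟨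
    - (suc m · 1#) - suc n · 1#          ∎

  ⁺◃-homo : ∀ n → ⟦ ±.+ ◃ n ⟧ᶻ ≈ n · 1#
  ⁺◃-homo zero    = refl
  ⁺◃-homo (suc n) = refl

  ⁻◃-homo : ∀ n → ⟦ ±.- ◃ n ⟧ᶻ ≈ - (n · 1#)
  ⁻◃-homo zero    = sym -0#≈0#
  ⁻◃-homo (suc n) = refl

  *-homo : ∀ i j → ⟦ i ℤ.* j ⟧ᶻ ≈ ⟦ i ⟧ᶻ * ⟦ j ⟧ᶻ
  *-homo (+ m)    (+ n)    = trans (⁺◃-homo (m ℕ.* n)) (×1-homo-* m n)
  *-homo (+ m)    -[1+ n ] = begin
    ⟦ ±.- ◃ (m ℕ.* suc n) ⟧ᶻ   ≈⟨ ⁻◃-homo (m ℕ.* suc n) ⟩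
    - ((m ℕ.* suc n) · 1#)        ≈⟨ -‿cong (×1-homo-* m (suc n)) ⟩
    - (m · 1# * (suc n · 1#))     ≈⟨ -‿distribʳ-* (m · 1#) (suc n · 1#) ⟩
    m · 1# * - (suc n · 1#)       ∎
  *-homo -[1+ m ] (+ n)    = begin
    ⟦ ±.- ◃ (suc m ℕ.* n) ⟧ᶻ   ≈⟨ ⁻◃-homo (suc m ℕ.* n) ⟩
    - ((suc m ℕ.* n) · 1#)        ≈⟨ -‿cong (×1-homo-* (suc m) n) ⟩
    - (suc m · 1# * (n · 1#))     ≈⟨ -‿distribˡ-* _ _ ⟩
    - (suc m · 1#) * (n · 1#)     ∎
  *-homo -[1+ m ] -[1+ n ] = begin
    (suc m ℕ.* suc n) · 1#              ≈⟨ ×1-homo-* (suc m) (suc n) ⟩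
    suc m · 1# * (suc n · 1#)           ≈⟨ -‿involutive _ ⟨
    - - (suc m · 1# * (suc n · 1#))     ≈⟨ -‿cong (-‿distribʳ-* _ _) ⟩
    - (suc m · 1# * - (suc n · 1#))     ≈⟨ -‿distribˡ-* _ _ ⟩
    - (suc m · 1#) * - (suc n · 1#)     ∎

  morphism : ℤ.+-*-rawRing -Raw-AlmostCommutative⟶ fromCommutativeRing R
  morphism = record
    { ⟦_⟧    = ⟦_⟧ᶻ
    ; +-homo = +-homo
    ; *-homo = *-homo
    ; -‿homo = neg-homo
    ; 0-homo = refl
    ; 1-homo = refl
    }

  _≟ᶻ_ : ∀ i j → Maybe (⟦ i ⟧ᶻ ≈ ⟦ j ⟧ᶻ)
  i ≟ᶻ j with i ℤ.≟ j
  ... | yes i≡j = just (reflexive (≡.cong ⟦_⟧ᶻ i≡j))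
  ... | no  _   = nothing

  open Algebra.Solver.Ring ℤ.+-*-rawRing (fromCommutativeRing R) morphism _≟ᶻ_ public

-- Order and sign arithmetic in the field.

module OrderedField (R : RealField) where
  open RealField R
  open Algebra.Properties.Ring ring public using (-0#≈0#; -‿involutive)
  open ℤ-Coefficients commutativeRing
  open IsStrictTotalOrder isStrictTotalOrder public
    using (compare; <-respʳ-≈; <-respˡ-≈)
    renaming (trans to <-trans; irrefl to <-irrefl; asym to <-asym)

  :0 :1 : ∀ {n} → Polynomial n
  :0 = con (ℤ.+ 0)
  :1 = con (ℤ.+ 1)

  <⇒0<- : ∀ {x y} → x < y → 0# < y - x
  <⇒0<- {x} x<y = <-respˡ-≈ (-‿inverseʳ x) (+-monoˡ-< (- x) x<y)

  0<-⇒< : ∀ {x y} → 0# < y - x → x < y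
  0<-⇒< {x} {y} p = <-respˡ-≈ (+-identityˡ x)
    (<-respʳ-≈ (solve 2 (λ x y → y :- x :+ x := y) refl x y) (+-monoˡ-< x p))

  ≤⇒0≤- : ∀ {x y} → x ≤ y → 0# ≤ y - x
  ≤⇒0≤- (inj₁ x<y) = inj₁ (<⇒0<- x<y)
  ≤⇒0≤- {x} (inj₂ x≈y) = inj₂ (sym (trans (+-congʳ (sym x≈y)) (-‿inverseʳ x)))

  0≤-⇒≤ : ∀ {x y} → 0# ≤ y - x → x ≤ y
  0≤-⇒≤ (inj₁ p) = inj₁ (0<-⇒< p)
  0≤-⇒≤ {x} {y} (inj₂ p) = inj₂ (trans (sym (+-identityˡ x))
    (trans (+-congʳ p) (solve 2 (λ x y → y :- x :+ x := y) refl x y)))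

  0<-resp : ∀ {x y} → x ≈ y → 0# < x → 0# < y
  0<-resp = <-respʳ-≈

  0≤-resp : ∀ {x y} → x ≈ y → 0# ≤ x → 0# ≤ y
  0≤-resp x≈y (inj₁ p) = inj₁ (<-respʳ-≈ x≈y p)
  0≤-resp x≈y (inj₂ p) = inj₂ (trans p x≈y)

  <0⇒0<- : ∀ {x} → x < 0# → 0# < - x
  <0⇒0<- x<0 = 0<-resp (+-identityˡ _) (<⇒0<- x<0)

  0<⇒≉ : ∀ {x} → 0# < x → x ≉ 0#
  0<⇒≉ 0<x x≈0 = <-irrefl (sym x≈0) 0<x

  -- The negative case is phrased as positivity of `- x`, so that each strict case feeds the
  -- positivity lemmas directly.
  data Sign (x : ℝ) : Set where
    positive : 0# < x → Sign x
    null     : x ≈ 0# → Sign x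
    negative : 0# < - x → Sign x

  sign : ∀ x → Sign x
  sign x with compare 0# x
  ... | tri< p _ _ = positive p
  ... | tri≈ _ p _ = null (sym p)
  ... | tri> _ _ p = negative (<0⇒0<- p)

  ¬both-signs : ∀ {x} → 0# < x → ¬ (0# < - x)
  ¬both-signs {x} p n = <-asym p
    (<-respˡ-≈ (+-identityˡ x) (<-respʳ-≈ (-‿inverseˡ x) (+-monoˡ-< x n)))

  ¬0<⇒0≤- : ∀ {x} → ¬ (0# < x) → 0# ≤ - x
  ¬0<⇒0≤- {x} ¬p with sign x
  ... | positive p = contradiction p ¬p
  ... | null p     = inj₂ (sym (trans (-‿cong p) -0#≈0#))
  ... | negative p = inj₁ p

  0≤-⇒¬0< : ∀ {x} → 0# ≤ - x → ¬ (0# < x)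
  0≤-⇒¬0< (inj₁ p) q = ¬both-signs q p
  0≤-⇒¬0< {x} (inj₂ p) q = 0<⇒≉ q (trans (sym (-‿involutive x))
    (trans (-‿cong (sym p)) -0#≈0#))

  +-pos : ∀ {x y} → 0# < x → 0# < y → 0# < x + y
  +-pos {x} {y} p q = <-trans q (<-respˡ-≈ (+-identityˡ y) (+-monoˡ-< y p))

  +-pos-nonneg : ∀ {x y} → 0# < x → 0# ≤ y → 0# < x + y
  +-pos-nonneg p (inj₁ q) = +-pos p q
  +-pos-nonneg p (inj₂ q) = 0<-resp (trans (sym (+-identityʳ _)) (+-congˡ q)) p

  +-nonneg-pos : ∀ {x y} → 0# ≤ x → 0# < y → 0# < x + y
  +-nonneg-pos p q = 0<-resp (+-comm _ _) (+-pos-nonneg q p)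

  +-nonneg : ∀ {x y} → 0# ≤ x → 0# ≤ y → 0# ≤ x + y
  +-nonneg (inj₁ p) q = inj₁ (+-pos-nonneg p q)
  +-nonneg (inj₂ p) q = 0≤-resp (trans (sym (+-identityˡ _)) (+-congʳ p)) q

  *-nonneg : ∀ {x y} → 0# ≤ x → 0# ≤ y → 0# ≤ x * y
  *-nonneg (inj₁ p) (inj₁ q) = inj₁ (*-pos p q)
  *-nonneg {x} {y} (inj₂ p) _        = inj₂ (trans (sym (zeroˡ y)) (*-congʳ p))
  *-nonneg {x} {y} (inj₁ _) (inj₂ q) = inj₂ (trans (sym (zeroʳ x)) (*-congˡ q))

  sq-pos : ∀ {x} → x ≉ 0# → 0# < x * x
  sq-pos {x} x≉0 with sign x
  ... | positive p = *-pos p p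
  ... | null p     = contradiction p x≉0
  ... | negative p = 0<-resp (solve 1 (λ x → (:- x) :* (:- x) := x :* x) refl x) (*-pos p p)

  sq-nonneg : ∀ x → 0# ≤ x * x
  sq-nonneg x with sign x
  ... | positive p = inj₁ (*-pos p p)
  ... | null p     = inj₂ (sym (trans (*-congʳ p) (zeroˡ x)))
  ... | negative p = inj₁ (0<-resp (solve 1 (λ x → (:- x) :* (:- x) := x :* x) refl x) (*-pos p p))

  0<1 : 0# < 1#
  0<1 = 0<-resp (*-identityˡ 1#) (sq-pos (λ p → 0≉1 (sym p)))

  0<2 : 0# < 1# + 1#
  0<2 = +-pos 0<1 0<1

  -- Most sign deductions below multiply the goal by a suitable factor, often a square, and write
  -- the result as a sum of positive terms. Asking only for a nonnegative factor lets any square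
  -- serve as it stands.
  *-cancel-pos : ∀ {x y} → 0# ≤ x → 0# < x * y → 0# < y
  *-cancel-pos {x} {y} 0≤x p with sign y
  ... | positive q = q
  ... | null q     = contradiction (trans (*-congˡ q) (zeroʳ x)) (0<⇒≉ p)
  ... | negative q = contradiction p (0≤-⇒¬0<
          (0≤-resp (solve 2 (λ x y → x :* :- y := :- (x :* y)) refl x y) (*-nonneg 0≤x (inj₁ q))))

  *-≉0ˡ : ∀ {x y} → x * y ≉ 0# → x ≉ 0#
  *-≉0ˡ {x} {y} p q = p (trans (*-congʳ q) (zeroˡ y))

  *-≉0ʳ : ∀ {x y} → x * y ≉ 0# → y ≉ 0#
  *-≉0ʳ {x} {y} p q = p (trans (*-congˡ q) (zeroʳ x))

  ≉0-sum-sq : ∀ {x y} → ¬ (x ≈ 0# × y ≈ 0#) → 0# < x * x + y * y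
  ≉0-sum-sq {x} {y} p with sign x
  ... | positive q = +-pos-nonneg (*-pos q q) (sq-nonneg y)
  ... | null q     = +-nonneg-pos (sq-nonneg x) (sq-pos λ r → p (q , r))
  ... | negative q = +-pos-nonneg (sq-pos (λ r → 0<⇒≉ q (trans (-‿cong r)
                       -0#≈0#))) (sq-nonneg y)

  recip : ∀ {x} → x ≉ 0# → ∃[ y ] y * x ≈ 1#
  recip {x} p with inverse x p
  ... | y , q = y , trans (*-comm y x) q

  recip-≉0 : ∀ {x y} → y * x ≈ 1# → y ≉ 0#
  recip-≉0 p = *-≉0ˡ (λ q → 0≉1 (trans (sym q) p))

  recip-pos : ∀ {x y} → 0# < x → y * x ≈ 1# → 0# < y
  recip-pos p q = *-cancel-pos (inj₁ p) (0<-resp (trans (sym q) (*-comm _ _)) 0<1)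

  *-cancelˡ-0 : ∀ {x y} → x ≉ 0# → x * y ≈ 0# → y ≈ 0#
  *-cancelˡ-0 {x} {y} x≉0 p with recip x≉0
  ... | z , zx≈1 = trans (sym (*-identityˡ y)) (trans (*-congʳ (sym zx≈1))
        (trans (*-assoc z x y) (trans (*-congˡ p) (zeroʳ z))))

  *-≉0 : ∀ {x y} → x ≉ 0# → y ≉ 0# → x * y ≉ 0#
  *-≉0 p q r = q (*-cancelˡ-0 p r)

  -- |l| < 1 + l² serves as a bound on |l| that needs no case distinction.
  bound : ℝ → ℝ
  bound l = 1# + l * l

  0<bound : ∀ l → 0# < bound l
  0<bound l = +-pos-nonneg 0<1 (sq-nonneg l)

  -- The hypotheses say |h| < ε. Four times the claim is a combination of ε - h and ε + h with
  -- positive weights, which replaces any case distinction on the signs of `l` and `h`.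
  bound-product : ∀ {ε h} l → 0# < ε + h → 0# < ε - h → 0# < ε * bound l + l * h
  bound-product {ε} {h} l p q = *-cancel-pos (inj₁ (+-pos 0<2 0<2)) (0<-resp
    (solve 3 (λ ε h l →
      (ε :- h) :* (:1 :+ l :* l :+ (:1 :- l) :* (:1 :- l)) :+
      (ε :+ h) :* (:1 :+ l :* l :+ (:1 :+ l) :* (:1 :+ l)) :=
      (:1 :+ :1 :+ (:1 :+ :1)) :* (ε :* (:1 :+ l :* l) :+ l :* h)) refl ε h l)
    (+-pos (*-pos q (+-pos-nonneg (0<bound l) (sq-nonneg _)))
           (*-pos p (+-pos-nonneg (0<bound l) (sq-nonneg _)))))

-- Vector algebra in three coordinates.

module Coordinates {A : Set} (_+_ _*_ : A → A → A) (-_ : A → A) where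
  private
    infixl 6 _⊕_ _⊝_
    infixl 7 _⊗_
    _⊕_ = _+_
    _⊗_ = _*_
    _⊝_ : A → A → A
    x ⊝ y = x + (- y)

  -- The operations are parameters so that the same formulas can be read over the field and, as the
  -- module `P` below, over solver polynomials.
  dot : A × A × A → A × A × A → A
  dot (x , y , w) (x′ , y′ , w′) = x ⊗ x′ ⊕ y ⊗ y′ ⊕ w ⊗ w′

  cross : A × A × A → A × A × A → A × A × A
  cross (x , y , w) (x′ , y′ , w′) =
    y ⊗ w′ ⊝ w ⊗ y′ , w ⊗ x′ ⊝ x ⊗ w′ , x ⊗ y′ ⊝ y ⊗ x′

  det : A × A × A → A × A × A → A × A × A → A
  det u v w = dot (cross u v) w

-- Linear forms and open sets of the projective plane.

module Topology (R : RealField) where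
  open RealField R
  open Geometry R
  open OrderedField R
  open ℤ-Coefficients commutativeRing
  open Coordinates _+_ _*_ -_ public
  module P {n} = Coordinates {Polynomial n} _:+_ _:*_ :-_

  open Setoid ℝ³-setoid public using ()
    renaming (refl to ≈³-refl; sym to ≈³-sym; trans to ≈³-trans)

  dot-cong : ∀ {l l′ u u′} → l ≈³ l′ → u ≈³ u′ → dot l u ≈ dot l′ u′
  dot-cong (p , q , r) (p′ , q′ , r′) =
    +-cong (+-cong (*-cong p p′) (*-cong q q′)) (*-cong r r′)

  dot-· : ∀ l k u → dot l (k ·³ u) ≈ k * dot l u
  dot-· (a , b , c) k (x , y , w) = solve 7 (λ a b c k x y w →
    P.dot (a , b , c) (k :* x , k :* y , k :* w) := k :* P.dot (a , b , c) (x , y , w))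
    refl a b c k x y w

  dot-+ : ∀ l u v → dot l (u +³ v) ≈ dot l u + dot l v
  dot-+ (a , b , c) (x , y , w) (x′ , y′ , w′) = solve 9 (λ a b c x y w x′ y′ w′ →
    P.dot (a , b , c) (x :+ x′ , y :+ y′ , w :+ w′) :=
    P.dot (a , b , c) (x , y , w) :+ P.dot (a , b , c) (x′ , y′ , w′))
    refl a b c x y w x′ y′ w′

  -³_ : ℝ³ → ℝ³
  -³ (x , y , w) = - x , - y , - w

  dot-neg : ∀ l u → dot (-³ l) u ≈ - dot l u
  dot-neg (a , b , c) (x , y , w) = solve 6 (λ a b c x y w →
    P.dot (:- a , :- b , :- c) (x , y , w) := :- P.dot (a , b , c) (x , y , w))
    refl a b c x y w

  dot-scale : ∀ k l u → dot (k ·³ l) u ≈ k * dot l u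
  dot-scale k (a , b , c) (x , y , w) = solve 7 (λ k a b c x y w →
    P.dot (k :* a , k :* b , k :* c) (x , y , w) := k :* P.dot (a , b , c) (x , y , w))
    refl k a b c x y w

  ·³-cong : ∀ {k k′ u u′} → k ≈ k′ → u ≈³ u′ → k ·³ u ≈³ k′ ·³ u′
  ·³-cong p (q , r , s) = *-cong p q , *-cong p r , *-cong p s

  ·³-assoc : ∀ k m u → (k * m) ·³ u ≈³ k ·³ m ·³ u
  ·³-assoc k m (x , y , w) = *-assoc k m x , *-assoc k m y , *-assoc k m w

  ·³-identity : ∀ u → 1# ·³ u ≈³ u
  ·³-identity (x , y , w) = *-identityˡ x , *-identityˡ y , *-identityˡ w

  ·³-cancel : ∀ {k u v} → k ≉ 0# → k ·³ u ≈³ v → u ∼ v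
  ·³-cancel {k} {u} k≉0 p with recip k≉0
  ... | m , mk≈1 = m , recip-≉0 mk≈1 ,
    ≈³-trans (≈³-sym (·³-identity u))
    (≈³-trans (·³-cong (sym mk≈1) ≈³-refl)
    (≈³-trans (·³-assoc m k u) (·³-cong refl p)))

  ≈³⇒∼ : ∀ {u v} → u ≈³ v → u ∼ v
  ≈³⇒∼ p = 1# , (λ 1≈0 → 0≉1 (sym 1≈0)) , ≈³-trans p (≈³-sym (·³-identity _))

  ∼-trans : ∀ {u v w} → u ∼ v → v ∼ w → u ∼ w
  ∼-trans (k , k≉0 , p) (m , m≉0 , q) =
    k * m , *-≉0 k≉0 m≉0 , ≈³-trans p (≈³-trans (·³-cong refl q) (≈³-sym (·³-assoc k m _)))

  min : ∀ {x y} → 0# < x → 0# < y → ∃[ z ] 0# < z × z ≤ x × z ≤ y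
  min {x} {y} p q with compare x y
  ... | tri< x<y _ _ = x , p , inj₂ refl , inj₁ x<y
  ... | tri≈ _ x≈y _ = x , p , inj₂ refl , inj₂ x≈y
  ... | tri> _ _ y<x = y , q , inj₁ y<x , inj₂ refl

  Near-mono : ∀ {ε ε′ u v} → ε ≤ ε′ → Near ε u v → Near ε′ u v
  Near-mono {ε} {ε′} le ((a , b) , (c , d) , (e , f)) =
    (mono a , mono b) , (mono c , mono d) , (mono e , mono f)
    where
    mono : ∀ {s t} → s < t + ε → s < t + ε′
    mono {s} {t} p = 0<-⇒< (0<-resp
      (solve 4 (λ s t ε ε′ → t :+ ε :- s :+ (ε′ :- ε) := t :+ ε′ :- s) refl s t ε ε′)
      (+-pos-nonneg (<⇒0<- p) (≤⇒0≤- le)))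

  -- Moving each coordinate by less than ε changes the value `d` of the form by less than ε `M`,
  -- where `M` adds up the bounds of the coefficients. Hence ε = `d` / `M` works.
  dot-stays-positive : ∀ l u → 0# < dot l u →
    ∃[ ε ] 0# < ε × (∀ v → Near ε u v → 0# < dot l v)
  dot-stays-positive (a , b , c) (x , y , w) pos = d * i , *-pos pos (recip-pos 0<M iM≈1) , near
    where
    d = dot (a , b , c) (x , y , w)
    M = bound a + bound b + bound c
    0<M : 0# < M
    0<M = +-pos (+-pos (0<bound a) (0<bound b)) (0<bound c)
    i = proj₁ (recip (0<⇒≉ 0<M))
    iM≈1 = proj₂ (recip (0<⇒≉ 0<M))

    part : ∀ {ε s t} α → s < t + ε → t < s + ε → 0# < ε * bound α + (α * t - α * s)
    part {ε} {s} {t} α p q = 0<-resp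
      (solve 5 (λ ε β α s t → ε :* β :+ α :* (t :- s) := ε :* β :+ (α :* t :- α :* s)) refl
        ε (bound α) α s t)
      (bound-product α
        (0<-resp (solve 3 (λ s t ε → t :+ ε :- s := ε :+ (t :- s)) refl s t ε) (<⇒0<- p))
        (0<-resp (solve 3 (λ s t ε → s :+ ε :- t := ε :- (t :- s)) refl s t ε) (<⇒0<- q)))

    -- The three slacks add up to exactly the new value of the form, since m (A + B + C) cancels the
    -- old one.
    total : ∀ m A B C p q r p′ q′ r′ → m * (A + B + C) ≈ p + q + r →
      m * A + (p′ - p) + (m * B + (q′ - q)) + (m * C + (r′ - r)) ≈ p′ + q′ + r′
    total m A B C p q r p′ q′ r′ e = trans
      (solve 10 (λ m A B C p q r p′ q′ r′ →
         m :* A :+ (p′ :- p) :+ (m :* B :+ (q′ :- q)) :+ (m :* C :+ (r′ :- r)) :=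
         p′ :+ q′ :+ r′ :+ (m :* (A :+ B :+ C) :- (p :+ q :+ r)))
         refl m A B C p q r p′ q′ r′)
      (trans (+-congˡ (trans (+-congʳ e) (-‿inverseʳ _))) (+-identityʳ _))

    near : ∀ v → Near (d * i) (x , y , w) v → 0# < dot (a , b , c) v
    near (x′ , y′ , w′) ((p , p′) , (q , q′) , (r , r′)) = 0<-resp
      (total (d * i) (bound a) (bound b) (bound c) (a * x) (b * y) (c * w) (a * x′) (b * y′) (c * w′)
        (trans (*-assoc d i M) (trans (*-congˡ iM≈1) (*-identityʳ d))))
      (+-pos (+-pos (part a p p′) (part b q q′)) (part c r r′))

  both-stay-positive : ∀ l m u → 0# < dot l u → 0# < dot m u →
    ∃[ ε ] 0# < ε × (∀ v → Near ε u v → 0# < dot l v * dot m v)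
  both-stay-positive l m u p q =
    let ε , 0<ε , f = dot-stays-positive l u p
        ε′ , 0<ε′ , f′ = dot-stays-positive m u q
        η , 0<η , η≤ε , η≤ε′ = min 0<ε 0<ε′
    in η , 0<η , λ v n →
         *-pos (f v (Near-mono {u = u} {v} η≤ε n)) (f′ v (Near-mono {u = u} {v} η≤ε′ n))

  neg*neg : ∀ x y → - x * - y ≈ x * y
  neg*neg = solve 2 (λ x y → :- x :* :- y := x :* y) refl

  -- A single form has no sign at a projective point, but a product of two forms is multiplied by a
  -- square when the representative is rescaled. All regions of the plane are therefore described by
  -- signs of such products.
  quadric-open : ∀ l m → Open (λ q → 0# < dot l (rep q) * dot m (rep q))
  quadric-open l m = record { respects = λ {p} {q} → respects {p} {q} ; interior = interior }
    where
    rescale : ∀ k a b → k * a * (k * b) ≈ k * k * (a * b)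
    rescale = solve 3 (λ k a b → k :* a :* (k :* b) := k :* k :* (a :* b)) refl

    respects : ∀ {p q} → p ≈ᴾ q → 0# < dot l (rep p) * dot m (rep p) →
               0# < dot l (rep q) * dot m (rep q)
    respects {p} {q} (k , k≉0 , e) pos = *-cancel-pos (inj₁ (sq-pos k≉0)) (0<-resp
      (trans (*-cong (trans (dot-cong {l} {l} {rep p} ≈³-refl e) (dot-· l k (rep q)))
                     (trans (dot-cong {m} {m} {rep p} ≈³-refl e) (dot-· m k (rep q))))
        (rescale k (dot l (rep q)) (dot m (rep q))))
      pos)

    interior : ∀ p → 0# < dot l (rep p) * dot m (rep p) →
      ∃[ ε ] 0# < ε × (∀ q → Near ε (rep p) (rep q) → 0# < dot l (rep q) * dot m (rep q))
    interior p pos with sign (dot l (rep p))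
    ... | positive s =
      let ε , 0<ε , f = both-stay-positive l m (rep p) s (*-cancel-pos (inj₁ s) pos)
      in ε , 0<ε , λ q → f (rep q)
    ... | null s = contradiction (trans (*-congʳ s) (zeroˡ _)) (0<⇒≉ pos)
    -- Negating both forms keeps their product and reduces this to the case of two positive values.
    ... | negative s =
      let ε , 0<ε , f = both-stay-positive (-³ l) (-³ m) (rep p)
            (0<-resp (sym (dot-neg l (rep p))) s)
            (0<-resp (sym (dot-neg m (rep p)))
              (*-cancel-pos (inj₁ s) (0<-resp (sym (neg*neg _ _)) pos)))
      in ε , 0<ε , λ q n →
           0<-resp (trans (*-cong (dot-neg l (rep q)) (dot-neg m (rep q))) (neg*neg _ _)) (f (rep q) n)

-- Connectedness along segments, by a supremum argument.

module Connectedness (R : RealField) where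
  open RealField R
  open Geometry R
  open OrderedField R
  open ℤ-Coefficients commutativeRing
  open Topology R

  -- The radius depends on the direction `d` and on ε only: δ is ε divided by the sum of the bounds
  -- of the three coordinates of `d`, so the same δ controls each coordinate.
  displacement-near : ∀ d {ε} → 0# < ε → ∃[ δ ] 0# < δ ×
    (∀ {h u v} → 0# < δ + h → 0# < δ - h → v ≈³ u +³ h ·³ d → Near ε u v)
  displacement-near (a , b , c) {ε} 0<ε = δ , 0<δ , near
    where
    M = bound a + bound b + bound c
    0<M : 0# < M
    0<M = +-pos (+-pos (0<bound a) (0<bound b)) (0<bound c)
    i = proj₁ (recip (0<⇒≉ 0<M))
    iM≈1 = proj₂ (recip (0<⇒≉ 0<M))
    δ = ε * i
    0<δ = *-pos 0<ε (recip-pos 0<M iM≈1)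

    δM≈ε : δ * M ≈ ε
    δM≈ε = trans (*-assoc ε i M) (trans (*-congˡ iM≈1) (*-identityʳ ε))

    smaller : ∀ {h} l B → 0# ≤ B → bound l + B ≈ M → 0# < δ + h → 0# < δ - h →
              0# < ε + l * h
    smaller {h} l B 0≤B e p q = 0<-resp
      (trans (solve 5 (λ δ β l h B → δ :* β :+ l :* h :+ δ :* B := δ :* (β :+ B) :+ l :* h)
                refl δ (bound l) l h B)
             (+-congʳ (trans (*-congˡ e) δM≈ε)))
      (+-pos-nonneg (bound-product l p q) (*-nonneg (inj₁ 0<δ) 0≤B))

    close : ∀ {h} l B → 0# ≤ B → bound l + B ≈ M → 0# < δ + h → 0# < δ - h →
            ∀ {s t} → t ≈ s + h * l → s < t + ε × t < s + ε
    close {h} l B 0≤B e p q {s} {t} t≈ =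
      0<-⇒< (0<-resp
        (trans (solve 4 (λ ε s h l → ε :+ l :* h := s :+ h :* l :+ ε :- s) refl ε s h l)
               (+-congʳ (+-congʳ (sym t≈))))
        (smaller l B 0≤B e p q)) ,
      0<-⇒< (0<-resp
        (trans (solve 4 (λ ε s h l → ε :+ l :* :- h := s :+ ε :- (s :+ h :* l)) refl ε s h l)
               (+-congˡ (-‿cong (sym t≈))))
        (smaller l B 0≤B e q (0<-resp (solve 2 (λ δ h → δ :+ h := δ :- :- h) refl δ h) p)))

    near : ∀ {h u v} → 0# < δ + h → 0# < δ - h → v ≈³ u +³ h ·³ (a , b , c) → Near ε u v
    near p q (e , f , g) =
      close a (bound b + bound c) (inj₁ (+-pos (0<bound b) (0<bound c)))
        (solve 3 (λ a b c → a :+ (b :+ c) := a :+ b :+ c) refl _ _ _) p q e ,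
      close b (bound a + bound c) (inj₁ (+-pos (0<bound a) (0<bound c)))
        (solve 3 (λ a b c → b :+ (a :+ c) := a :+ b :+ c) refl _ _ _) p q f ,
      close c (bound a + bound b) (inj₁ (+-pos (0<bound a) (0<bound b)))
        (solve 3 (λ a b c → c :+ (a :+ b) := a :+ b :+ c) refl _ _ _) p q g

  _-³_ : ℝ³ → ℝ³ → ℝ³
  (x , y , w) -³ (x′ , y′ , w′) = x - x′ , y - y′ , w - w′

  segment-shift : ∀ x y s t → segment x y t ≈³ segment x y s +³ (t - s) ·³ (y -³ x)
  segment-shift (x , y , w) (x′ , y′ , w′) s t = shift x x′ s t , shift y y′ s t , shift w w′ s t
    where
    shift : ∀ x x′ s t → (1# - t) * x + t * x′ ≈ (1# - s) * x + s * x′ + (t - s) * (x′ - x)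
    shift = solve 4 (λ x x′ s t → (:1 :- t) :* x :+ t :* x′ :=
      (:1 :- s) :* x :+ s :* x′ :+ (t :- s) :* (x′ :- x)) refl

  module _ (K U V : Pred ℙ² 0ℓ) (openU : Open U) (openV : Open V)
           (cover : K ⊆ U ∪ V) (disjoint : K ∩ U ⊥ K ∩ V)
           (x y : ℝ³) where

    OnSegment : Pred ℙ² 0ℓ → ℝ → Set
    OnSegment W t = ∃[ q ] rep q ≈³ segment x y t × q ∈ K × q ∈ W

    module _ (path : ∀ t → 0# ≤ t → t ≤ 1# → ∃[ q ] rep q ≈³ segment x y t × q ∈ K) where

      onSegment-cover : ∀ t → 0# ≤ t → t ≤ 1# → OnSegment U t ⊎ OnSegment V t
      onSegment-cover t p r with path t p r
      ... | q , e , q∈K with cover q∈K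
      ... | inj₁ q∈U = inj₁ (q , e , q∈K , q∈U)
      ... | inj₂ q∈V = inj₂ (q , e , q∈K , q∈V)

      onSegment-disjoint : ∀ {t} → OnSegment U t → ¬ OnSegment V t
      onSegment-disjoint (q , e , q∈K , q∈U) (q′ , e′ , q′∈K , q′∈V) =
        disjoint {q} ((q∈K , q∈U) ,
          (q∈K , Open.respects openV {q′} {q} (≈³⇒∼ (≈³-trans e′ (≈³-sym e))) q′∈V))

      onSegment-open : ∀ {W s} → Open W → OnSegment W s →
        ∃[ δ ] 0# < δ × (∀ t → 0# ≤ t → t ≤ 1# → s - δ < t → t < s + δ → OnSegment W t)
      onSegment-open {W} {s} openW (q , e , q∈K , q∈W) =
        let ε , 0<ε , f = Open.interior openW q q∈W
            δ , 0<δ , g = displacement-near (y -³ x) 0<ε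
        in δ , 0<δ , λ t p r above below →
          let q′ , e′ , q′∈K = path t p r in
          q′ , e′ , q′∈K , f q′ (g {t - s} {rep q} {rep q′}
            (0<-resp (solve 3 (λ s t δ → t :- (s :- δ) := δ :+ (t :- s)) refl s t δ) (<⇒0<- above))
            (0<-resp (solve 3 (λ s t δ → s :+ δ :- t := δ :- (t :- s)) refl s t δ) (<⇒0<- below))
            (≈³-trans e′ (≈³-trans (segment-shift x y s t) (+³-congʳ (≈³-sym e)))))
        where
        +³-congʳ : ∀ {u u′ v} → u ≈³ u′ → u +³ v ≈³ u′ +³ v
        +³-congʳ (p , q , r) = +-congʳ p , +-congʳ q , +-congʳ r

      -- Let `s` be the supremum of the parameters in `U`. If `s` were in `U`, so would be points
      -- beyond it or the end point itself; if `s` were in `V`, a whole interval below it would be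
      -- free of `U`.
      no-transition : OnSegment U 0# → ¬ OnSegment V 1#
      no-transition at0 at1 = [ inU , inV ]′ (onSegment-cover s 0≤s s≤1)
        where
        A : Pred ℝ 0ℓ
        A t = (0# ≤ t × t ≤ 1#) × OnSegment U t

        0≤1 : 0# ≤ 1#
        0≤1 = inj₁ 0<1

        sup = supremum A (0# , (inj₂ refl , 0≤1) , at0) (1# , λ _ z → proj₂ (proj₁ z))
        s = proj₁ sup
        upper = proj₁ (proj₂ sup)
        least = proj₂ (proj₂ sup)

        0≤s : 0# ≤ s
        0≤s = upper 0# ((inj₂ refl , 0≤1) , at0)
        s≤1 : s ≤ 1#
        s≤1 = least 1# (λ _ z → proj₂ (proj₁ z))

        x-δ<x : ∀ {x δ} → 0# < δ → x - δ < x
        x-δ<x {x} {δ} p = 0<-⇒< (0<-resp (solve 2 (λ x δ → δ := x :- (x :- δ)) refl x δ) p)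

        ≤<-trans : ∀ {x y z} → x ≤ y → y < z → x < z
        ≤<-trans (inj₁ p) q = <-trans p q
        ≤<-trans (inj₂ p) q = <-respˡ-≈ (sym p) q
        <≤-trans : ∀ {x y z} → x < y → y ≤ z → x < z
        <≤-trans p (inj₁ q) = <-trans p q
        <≤-trans p (inj₂ q) = <-respʳ-≈ q p
        ≤-trans : ∀ {x y z} → x ≤ y → y ≤ z → x ≤ z
        ≤-trans p (inj₁ q) = inj₁ (≤<-trans p q)
        ≤-trans p (inj₂ q) = [ (λ r → inj₁ (<-respʳ-≈ q r)) , (λ r → inj₂ (trans r q)) ]′ p

        inV : ¬ OnSegment V s
        inU : ¬ OnSegment U s
        inU at =
          let δ , 0<δ , stay = onSegment-open openU at
              ½ , ½2≈1 = recip (0<⇒≉ 0<2)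
              0<½ = recip-pos 0<2 ½2≈1
              t = s + δ * ½
              s<t : s < t
              s<t = 0<-⇒< (0<-resp (solve 2 (λ s h → h := s :+ h :- s) refl s (δ * ½)) (*-pos 0<δ 0<½))
              t<s+δ : t < s + δ
              t<s+δ = 0<-⇒< (0<-resp
                (trans (solve 3 (λ s δ ½ → δ :* ½ :=
                          s :+ δ :* (½ :* (:1 :+ :1)) :- (s :+ δ :* ½)) refl s δ ½)
                       (+-congʳ (+-congˡ (trans (*-congˡ ½2≈1) (*-identityʳ δ)))))
                (*-pos 0<δ 0<½))
          in case compare t 1# of λ where
               (tri< t<1 _ _) → beyond stay s<t t<s+δ (inj₁ t<1)
               (tri≈ _ t≈1 _) → beyond stay s<t t<s+δ (inj₂ t≈1)
               -- Here 1 lies within δ of `s`, so the end point would be in `U` as well as in `V`.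
               (tri> _ _ 1<t) → onSegment-disjoint
                 (stay 1# 0≤1 (inj₂ refl) (<≤-trans (x-δ<x 0<δ) s≤1) (<-trans 1<t t<s+δ)) at1
          where
          beyond : ∀ {δ t} →
            (∀ t → 0# ≤ t → t ≤ 1# → s - δ < t → t < s + δ → OnSegment U t) →
            s < t → t < s + δ → ¬ t ≤ 1#
          beyond {δ} {t} stay s<t t<s+δ t≤1 = <-irrefl refl (<≤-trans s<t (upper t
            ((0≤t , t≤1) , stay t 0≤t t≤1 (<-trans (x-δ<x 0<δ) s<t) t<s+δ)))
            where
            0≤t = ≤-trans 0≤s (inj₁ s<t)
            0<δ : 0# < δ
            0<δ = 0<-resp (solve 2 (λ s δ → s :+ δ :- s := δ) refl s δ)
              (<⇒0<- (<-trans s<t t<s+δ))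

        inV at =
          let δ , 0<δ , stay = onSegment-open openV at
              -- A parameter of `A` closer to `s` than δ would be in both sets, so `s - δ` is an
              -- upper bound below the least one.
              bounded : ∀ t → t ∈ A → t ≤ s - δ
              bounded t t∈A = case compare t (s - δ) of λ where
                (tri< t< _ _) → inj₁ t<
                (tri≈ _ t≈ _) → inj₂ t≈
                (tri> _ _ <t) → contradiction
                  (stay t (proj₁ (proj₁ t∈A)) (proj₂ (proj₁ t∈A)) <t (≤<-trans (upper t t∈A)
                    (0<-⇒< (0<-resp (solve 2 (λ s δ → δ := s :+ δ :- s) refl s δ) 0<δ))))
                  (onSegment-disjoint (proj₂ t∈A))
          in <-irrefl refl (≤<-trans (least (s - δ) bounded) (x-δ<x 0<δ))

-- Signs of linear forms on connected sets.

module Cells (R : RealField) where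
  open RealField R
  open Geometry R
  open OrderedField R
  open ℤ-Coefficients commutativeRing
  open Topology R
  open Connectedness R

  -- The cross products form, up to the factor `det a b c`, the basis dual to the forms `a`, `b`,
  -- `c`, so the coefficients of a vector are the values of these forms.
  reciprocal-basis : ∀ a b c q → det a b c ·³ q ≈³
    dot a q ·³ cross b c +³ dot b q ·³ cross c a +³ dot c q ·³ cross a b
  reciprocal-basis (a₁ , a₂ , a₃) (b₁ , b₂ , b₃) (c₁ , c₂ , c₃) (q₁ , q₂ , q₃) =
      solve 12 (λ a₁ a₂ a₃ b₁ b₂ b₃ c₁ c₂ c₃ q₁ q₂ q₃ →
        let a = a₁ , a₂ , a₃; b = b₁ , b₂ , b₃; c = c₁ , c₂ , c₃; q = q₁ , q₂ , q₃ in
        P.det a b c :* q₁ := P.dot a q :* proj₁ (P.cross b c)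
          :+ P.dot b q :* proj₁ (P.cross c a) :+ P.dot c q :* proj₁ (P.cross a b))
        refl a₁ a₂ a₃ b₁ b₂ b₃ c₁ c₂ c₃ q₁ q₂ q₃
    , solve 12 (λ a₁ a₂ a₃ b₁ b₂ b₃ c₁ c₂ c₃ q₁ q₂ q₃ →
        let a = a₁ , a₂ , a₃; b = b₁ , b₂ , b₃; c = c₁ , c₂ , c₃; q = q₁ , q₂ , q₃ in
        P.det a b c :* q₂ := P.dot a q :* proj₁ (proj₂ (P.cross b c))
          :+ P.dot b q :* proj₁ (proj₂ (P.cross c a)) :+ P.dot c q :* proj₁ (proj₂ (P.cross a b)))
        refl a₁ a₂ a₃ b₁ b₂ b₃ c₁ c₂ c₃ q₁ q₂ q₃
    , solve 12 (λ a₁ a₂ a₃ b₁ b₂ b₃ c₁ c₂ c₃ q₁ q₂ q₃ →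
        let a = a₁ , a₂ , a₃; b = b₁ , b₂ , b₃; c = c₁ , c₂ , c₃; q = q₁ , q₂ , q₃ in
        P.det a b c :* q₃ := P.dot a q :* proj₂ (proj₂ (P.cross b c))
          :+ P.dot b q :* proj₂ (proj₂ (P.cross c a)) :+ P.dot c q :* proj₂ (proj₂ (P.cross a b)))
        refl a₁ a₂ a₃ b₁ b₂ b₃ c₁ c₂ c₃ q₁ q₂ q₃

  dot-crossˡ : ∀ a b → dot a (cross a b) ≈ 0#
  dot-crossˡ (a₁ , a₂ , a₃) (b₁ , b₂ , b₃) = solve 6 (λ a₁ a₂ a₃ b₁ b₂ b₃ →
    P.dot (a₁ , a₂ , a₃) (P.cross (a₁ , a₂ , a₃) (b₁ , b₂ , b₃)) := :0)
    refl a₁ a₂ a₃ b₁ b₂ b₃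

  dot-crossʳ : ∀ a b → dot b (cross a b) ≈ 0#
  dot-crossʳ (a₁ , a₂ , a₃) (b₁ , b₂ , b₃) = solve 6 (λ a₁ a₂ a₃ b₁ b₂ b₃ →
    P.dot (b₁ , b₂ , b₃) (P.cross (a₁ , a₂ , a₃) (b₁ , b₂ , b₃)) := :0)
    refl a₁ a₂ a₃ b₁ b₂ b₃

  dot-cross : ∀ a b c → dot c (cross a b) ≈ det a b c
  dot-cross (a₁ , a₂ , a₃) (b₁ , b₂ , b₃) (c₁ , c₂ , c₃) =
    solve 9 (λ a₁ a₂ a₃ b₁ b₂ b₃ c₁ c₂ c₃ →
      let a = a₁ , a₂ , a₃; b = b₁ , b₂ , b₃; c = c₁ , c₂ , c₃ in
      P.dot c (P.cross a b) := P.det a b c)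
      refl a₁ a₂ a₃ b₁ b₂ b₃ c₁ c₂ c₃

  det-cycle : ∀ a b c → det b c a ≈ det a b c
  det-cycle (a₁ , a₂ , a₃) (b₁ , b₂ , b₃) (c₁ , c₂ , c₃) =
    solve 9 (λ a₁ a₂ a₃ b₁ b₂ b₃ c₁ c₂ c₃ →
      let a = a₁ , a₂ , a₃; b = b₁ , b₂ , b₃; c = c₁ , c₂ , c₃ in
      P.det b c a := P.det a b c)
      refl a₁ a₂ a₃ b₁ b₂ b₃ c₁ c₂ c₃

  dot-combination : ∀ m c v → dot m (combination c v) ≈
    c 0F * dot m (v 0F) + c 1F * dot m (v 1F) + c 2F * dot m (v 2F)
  dot-combination m c v = trans (dot-+ m _ _) (+-cong
    (trans (dot-+ m _ _) (+-cong (dot-· m _ _) (dot-· m _ _))) (dot-· m _ _))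

  -- The free factor `k` is later chosen to make all coefficients nonnegative, as membership in a
  -- `region` demands.
  ∼-combination : ∀ {D q k} s v → D ≉ 0# → k ≉ 0# → D ·³ q ≈³ combination s v →
    q ∼ combination (λ i → k * s i) v
  ∼-combination {D} {q} {k} s v D≉0 k≉0 e = ·³-cancel (*-≉0 k≉0 D≉0)
    (≈³-trans (·³-assoc k D q) (≈³-trans (·³-cong refl e)
      (scale _ _ _ _ _ _ , scale _ _ _ _ _ _ , scale _ _ _ _ _ _)))
    where
    scale : ∀ a b c x y z → k * (a * x + b * y + c * z) ≈ k * a * x + k * b * y + k * c * z
    scale = solve 7 (λ k a b c x y z → k :* (a :* x :+ b :* y :+ c :* z) :=
      k :* a :* x :+ k :* b :* y :+ k :* c :* z) refl k

  dot-0³ : ∀ m {u} → u ≈³ 0³ → dot m u ≈ 0#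
  dot-0³ m@(a , b , c) {u} e = trans (dot-cong {m} {m} {u} {0³} ≈³-refl e)
    (solve 3 (λ a b c → P.dot (a , b , c) (:0 , :0 , :0) := :0)
      refl a b c)

  -- Where neither form vanishes, the two signs of the product give a cover by two disjoint open
  -- sets; connectedness forbids meeting both.
  constant-sign : ∀ {C} → Connected C → ∀ l m → (∀ {q} → q ∈ C → dot l (rep q) ≉ 0#) →
    (∀ {q} → q ∈ C → dot m (rep q) ≉ 0#) → ∀ {p q} → p ∈ C → q ∈ C →
    0# < dot l (rep p) * dot m (rep p) → ¬ (0# < - (dot l (rep q) * dot m (rep q)))
  constant-sign {C} conn l m l≉0 m≉0 {p} {q} p∈C q∈C pos neg =
    conn _ _ (quadric-open l m) (quadric-open (-³ l) m) cover disjoint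
      ((p , p∈C , pos) , (q , q∈C , 0<-resp (sym (flip q)) neg))
    where
    flip : ∀ q → dot (-³ l) (rep q) * dot m (rep q) ≈ - (dot l (rep q) * dot m (rep q))
    flip q = trans (*-congʳ (dot-neg l (rep q)))
      (solve 2 (λ a b → :- a :* b := :- (a :* b)) refl (dot l (rep q)) (dot m (rep q)))

    cover : ∀ {q} → q ∈ C → 0# < dot l (rep q) * dot m (rep q)
                          ⊎ 0# < dot (-³ l) (rep q) * dot m (rep q)
    cover {q} q∈C with sign (dot l (rep q) * dot m (rep q))
    ... | positive s = inj₁ s
    ... | null s     = contradiction s (*-≉0 (l≉0 q∈C) (m≉0 q∈C))
    ... | negative s = inj₂ (0<-resp (sym (flip q)) s)

    disjoint : ∀ {q} → ¬ ((q ∈ C × 0# < dot l (rep q) * dot m (rep q)) ×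
                         (q ∈ C × 0# < dot (-³ l) (rep q) * dot m (rep q)))
    disjoint {q} ((_ , s) , (_ , t)) = ¬both-signs s (0<-resp (flip q) t)

  ≈0-stable : ∀ {x} → ¬ (x ≉ 0#) → x ≈ 0#
  ≈0-stable {x} ¬≉ with sign x
  ... | positive p = contradiction (0<⇒≉ p) ¬≉
  ... | null e     = e
  ... | negative p = contradiction (λ e → 0<⇒≉ p (trans (-‿cong e)
                       -0#≈0#)) ¬≉

  -- The triangle cut out by three independent linear forms.

  module DualTriangle (l : Fin 3 → ℝ³) (D≉0 : det (l 0F) (l 1F) (l 2F) ≉ 0#) where
    D : ℝ
    D = det (l 0F) (l 1F) (l 2F)

    -- Corner `i` is the intersection of the two lines other than the `i`-th. The signs of the forms
    -- select one of the four triangles bounded by the lines: the one on which all three forms have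
    -- the same sign.
    corners : Fin 3 → ℝ³
    corners 0F = cross (l 1F) (l 2F)
    corners 1F = cross (l 2F) (l 0F)
    corners 2F = cross (l 0F) (l 1F)

    dot-corners : ∀ i → dot (l i) (corners i) ≈ D
    dot-corners 0F = trans (dot-cross (l 1F) (l 2F) (l 0F)) (det-cycle (l 0F) (l 1F) (l 2F))
    dot-corners 1F = trans (dot-cross (l 2F) (l 0F) (l 1F))
      (trans (det-cycle (l 1F) (l 2F) (l 0F)) (det-cycle (l 0F) (l 1F) (l 2F)))
    dot-corners 2F = dot-cross (l 0F) (l 1F) (l 2F)

    coefficient : ∀ i c → dot (l i) (combination c corners) ≈ c i * D
    coefficient 0F c = trans (dot-combination (l 0F) c corners) (trans
      (+-cong (+-cong (*-congˡ (dot-corners 0F)) (*-congˡ (dot-crossʳ (l 2F) (l 0F))))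
              (*-congˡ (dot-crossˡ (l 0F) (l 1F))))
      (solve 4 (λ a b c D → a :* D :+ b :* :0 :+ c :* :0 := a :* D) refl _ _ _ _))
    coefficient 1F c = trans (dot-combination (l 1F) c corners) (trans
      (+-cong (+-cong (*-congˡ (dot-crossˡ (l 1F) (l 2F))) (*-congˡ (dot-corners 1F)))
              (*-congˡ (dot-crossʳ (l 0F) (l 1F))))
      (solve 4 (λ a b c D → a :* :0 :+ b :* D :+ c :* :0 := b :* D) refl _ _ _ _))
    coefficient 2F c = trans (dot-combination (l 2F) c corners) (trans
      (+-cong (+-cong (*-congˡ (dot-crossʳ (l 1F) (l 2F))) (*-congˡ (dot-crossˡ (l 2F) (l 0F))))
              (*-congˡ (dot-corners 2F)))
      (solve 4 (λ a b c D → a :* :0 :+ b :* :0 :+ c :* D := c :* D) refl _ _ _ _))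

    *D-cancel : ∀ {x} → x * D ≈ 0# → x ≈ 0#
    *D-cancel e = *-cancelˡ-0 D≉0 (trans (*-comm _ _) e)

    triangle : Triangle
    triangle = record
      { vertex      = λ i → [ corners i , (λ e → D≉0 (trans (sym (dot-corners i)) (dot-0³ (l i) e))) ]
      ; independent = λ c e i → *D-cancel (trans (sym (coefficient i c)) (dot-0³ (l i) e))
      }

    side : ℝ³ → Fin 3 → ℝ
    side q i = dot (l i) q

    decompose : ∀ q → D ·³ q ≈³ combination (side q) corners
    decompose = reciprocal-basis (l 0F) (l 1F) (l 2F)

    side-zero : ∀ q → (∀ i → side q i ≈ 0#) → q ≈³ 0³
    side-zero q e = vanish _ _ _ _ (proj₁ d) , vanish _ _ _ _ (proj₁ (proj₂ d)) ,
                    vanish _ _ _ _ (proj₂ (proj₂ d))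
      where
      d = decompose q
      vanish : ∀ t x y z → D * t ≈ side q 0F * x + side q 1F * y + side q 2F * z → t ≈ 0#
      vanish t x y z p = *-cancelˡ-0 D≉0 (trans p (trans
        (+-cong (+-cong (*-congʳ (e 0F)) (*-congʳ (e 1F))) (*-congʳ (e 2F)))
        (solve 3 (λ x y z → let o = :0 in o :* x :+ o :* y :+ o :* z := o) refl x y z)))

    side-∼ : ∀ {q c k} → q ≈³ k ·³ combination c corners → ∀ i → side q i ≈ k * D * c i
    side-∼ {q} {c} {k} e i = trans (dot-cong {l i} {l i} {q} ≈³-refl e)
      (trans (dot-· (l i) k (combination c corners)) (trans (*-congˡ (coefficient i c))
        (solve 3 (λ k c D → k :* (c :* D) := k :* D :* c) refl k (c i) D)))

    -- Each side value is the common factor `k * D` times a nonnegative coefficient, and the sign of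
    -- that factor cancels in a product of two side values.
    region-side : ∀ {q} → region triangle q → ∀ i j → 0# ≤ side (rep q) i * side (rep q) j
    region-side {q} (c , 0≤c , (k , k≉0 , e)) i j = 0≤-resp
      (trans (solve 4 (λ k D a b → k :* D :* (k :* D) :* (a :* b) := k :* D :* a :* (k :* D :* b))
               refl k D (c i) (c j))
             (sym (*-cong (side-∼ {rep q} {c} e i) (side-∼ {rep q} {c} e j))))
      (*-nonneg (sq-nonneg (k * D)) (*-nonneg (0≤c i) (0≤c j)))

    -- The sum `k` of the side values has their common sign, so multiplying by it makes all
    -- coefficients nonnegative. It is nonzero because the side values of a projective point do not
    -- all vanish.
    side-region : ∀ q → (∀ i j → 0# ≤ side (rep q) i * side (rep q) j) → region triangle q
    side-region q same = (λ i → k * side (rep q) i) , 0≤ks , ∼-combination s corners D≉0 k≉0 (decompose (rep q))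
      where
      s : Fin 3 → ℝ
      s = side (rep q)
      k = s 0F + s 1F + s 2F

      expand : ∀ i → s i * s 0F + s i * s 1F + s i * s 2F ≈ k * s i
      expand i = solve 4 (λ x a b c → x :* a :+ x :* b :+ x :* c := (a :+ b :+ c) :* x) refl
        (s i) (s 0F) (s 1F) (s 2F)

      0≤ks : ∀ i → 0# ≤ k * s i
      0≤ks i = 0≤-resp (expand i) (+-nonneg (+-nonneg (same i 0F) (same i 1F)) (same i 2F))

      0<ks : ∀ i → 0# < s i * s i → 0# < k * s i
      0<ks 0F p = 0<-resp (expand 0F) (+-pos-nonneg (+-pos-nonneg p (same 0F 1F)) (same 0F 2F))
      0<ks 1F p = 0<-resp (expand 1F) (+-pos-nonneg (+-nonneg-pos (same 1F 0F) p) (same 1F 2F))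
      0<ks 2F p = 0<-resp (expand 2F) (+-nonneg-pos (+-nonneg (same 2F 0F) (same 2F 1F)) p)

      k≉0 : k ≉ 0#
      k≉0 k≈0 = nonzero q (side-zero (rep q) λ i → ≈0-stable λ s≉0 →
        0<⇒≉ (0<ks i (sq-pos s≉0)) (trans (*-congʳ k≈0) (zeroˡ (s i))))

    -- The three forms strictly agree in sign; comparison with the form `0F` already fixes the sign
    -- of every pair.
    Interior : Pred ℙ² 0ℓ
    Interior q = 0# < side (rep q) 0F * side (rep q) 1F × 0# < side (rep q) 0F * side (rep q) 2F

    interior-side : ∀ q → Interior q → ∀ i → 0# < side (rep q) 0F * side (rep q) i
    interior-side q (p , r) 0F = sq-pos (*-≉0ˡ (0<⇒≉ p))
    interior-side q (p , r) 1F = p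
    interior-side q (p , r) 2F = r

    interior-sides : ∀ q → Interior q → ∀ i j → 0# < side (rep q) i * side (rep q) j
    interior-sides q int i j = *-cancel-pos (sq-nonneg (side (rep q) 0F)) (0<-resp
      (solve 3 (λ a x y → a :* x :* (a :* y) := a :* a :* (x :* y)) refl
        (side (rep q) 0F) (side (rep q) i) (side (rep q) j))
      (*-pos (interior-side q int i) (interior-side q int j)))

    interior-respects : ∀ {p q} → p ≈ᴾ q → Interior p → Interior q
    interior-respects {p} {q} e (a , b) =
      Open.respects (quadric-open (l 0F) (l 1F)) {p} {q} e a ,
      Open.respects (quadric-open (l 0F) (l 2F)) {p} {q} e b

    interior-nonempty : Satisfiable Interior
    interior-nonempty = [ u , (λ e → D≉0 (trans (sym (s 0F)) (dot-0³ (l 0F) e))) ] ,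
      pos 0F 1F , pos 0F 2F
      where
      u = combination (λ _ → 1#) corners
      s : ∀ i → side u i ≈ D
      s i = trans (coefficient i (λ _ → 1#)) (*-identityˡ D)
      pos : ∀ i j → 0# < side u i * side u j
      pos i j = 0<-resp (sym (*-cong (s i) (s j))) (sq-pos D≉0)

    -- Multiplying a representative by its side value at `0F` makes all its side values positive.
    -- The segment between two such representatives stays in the positive cone.
    interior-connected : Connected Interior
    interior-connected U V openU openV cover disjoint ((p , p∈I , p∈U) , (q , q∈I , q∈V)) =
      no-transition Interior U V openU openV cover disjoint x y path
        (start , start≈ , start∈I , Open.respects openU {p} {start} p≈start p∈U)
        (end , end≈ , end∈I , Open.respects openV {q} {end} q≈end q∈V)
      where
      x = side (rep p) 0F ·³ rep p
      y = side (rep q) 0F ·³ rep q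

      0<x : ∀ i → 0# < side x i
      0<x i = 0<-resp (sym (dot-· (l i) (side (rep p) 0F) (rep p))) (interior-side p p∈I i)
      0<y : ∀ i → 0# < side y i
      0<y i = 0<-resp (sym (dot-· (l i) (side (rep q) 0F) (rep q))) (interior-side q q∈I i)

      convex : ∀ {a b t} → 0# < a → 0# < b → 0# ≤ t → t ≤ 1# → 0# < (1# - t) * a + t * b
      convex 0<a 0<b (inj₁ 0<t) t≤1 =
        +-nonneg-pos (*-nonneg (≤⇒0≤- t≤1) (inj₁ 0<a)) (*-pos 0<t 0<b)
      convex {t = t} 0<a 0<b (inj₂ 0≈t) t≤1 =
        +-pos-nonneg (*-pos (0<-resp (trans (solve 0 (:1 := :1 :- :0) refl)
                                            (+-congˡ (-‿cong 0≈t))) 0<1) 0<a)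
                     (*-nonneg (inj₂ 0≈t) (inj₁ 0<b))

      side-segment : ∀ t i → side (segment x y t) i ≈ (1# - t) * side x i + t * side y i
      side-segment t i = trans (dot-+ (l i) _ _) (+-cong (dot-· (l i) (1# - t) x) (dot-· (l i) t y))

      0<segment : ∀ t → 0# ≤ t → t ≤ 1# → ∀ i → 0# < side (segment x y t) i
      0<segment t 0≤t t≤1 i = 0<-resp (sym (side-segment t i)) (convex (0<x i) (0<y i) 0≤t t≤1)

      path : ∀ t → 0# ≤ t → t ≤ 1# → ∃[ q ] rep q ≈³ segment x y t × q ∈ Interior
      path t 0≤t t≤1 =
        [ segment x y t , (λ e → 0<⇒≉ (0<segment t 0≤t t≤1 0F) (dot-0³ (l 0F) e)) ] ,
        ≈³-refl , *-pos (0<segment t 0≤t t≤1 0F) (0<segment t 0≤t t≤1 1F) ,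
                  *-pos (0<segment t 0≤t t≤1 0F) (0<segment t 0≤t t≤1 2F)

      0≤1 : 0# ≤ 1#
      0≤1 = inj₁ 0<1
      start = proj₁ (path 0# (inj₂ refl) 0≤1)
      start≈ = proj₁ (proj₂ (path 0# (inj₂ refl) 0≤1))
      start∈I = proj₂ (proj₂ (path 0# (inj₂ refl) 0≤1))
      end = proj₁ (path 1# 0≤1 (inj₂ refl))
      end≈ = proj₁ (proj₂ (path 1# 0≤1 (inj₂ refl)))
      end∈I = proj₂ (proj₂ (path 1# 0≤1 (inj₂ refl)))

      at0 : ∀ a b → (1# - 0#) * a + 0# * b ≈ a
      at0 = solve 2 (λ a b → (:1 :- :0) :* a :+ :0 :* b := a) refl
      at1 : ∀ a b → (1# - 1#) * a + 1# * b ≈ b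
      at1 = solve 2 (λ a b → (:1 :- :1) :* a :+ :1 :* b := b) refl

      p≈start : p ≈ᴾ start
      p≈start = ·³-cancel (*-≉0ˡ (0<⇒≉ (interior-side p p∈I 0F)))
        (sym (at0 _ _) , sym (at0 _ _) , sym (at0 _ _))
      q≈end : q ≈ᴾ end
      q≈end = ·³-cancel (*-≉0ˡ (0<⇒≉ (interior-side q q∈I 0F)))
        (sym (at1 _ _) , sym (at1 _ _) , sym (at1 _ _))

    -- On a connected set that avoids the three lines the products of side values keep their signs,
    -- so they agree with those at an interior point.
    interior-maximal : ∀ {X : Pred ℙ² 0ℓ} → (∀ {q} → q ∈ X → ∀ i → side (rep q) i ≉ 0#) →
      ∀ C → Connected C → C ⊆ X → Interior ⊆ C → C ⊆ Interior
    interior-maximal sides≉0 C conn C⊆X I⊆C {q} q∈C = same 1F , same 2F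
      where
      p = proj₁ interior-nonempty
      p∈I = proj₂ interior-nonempty

      same : ∀ i → 0# < side (rep q) 0F * side (rep q) i
      same i with sign (side (rep q) 0F * side (rep q) i)
      ... | positive s = s
      ... | null s     = contradiction s (*-≉0 (sides≉0 (C⊆X q∈C) 0F) (sides≉0 (C⊆X q∈C) i))
      ... | negative s = contradiction s (constant-sign conn (l 0F) (l i)
              (λ r∈C → sides≉0 (C⊆X r∈C) 0F) (λ r∈C → sides≉0 (C⊆X r∈C) i)
              (I⊆C {p} p∈I) q∈C (interior-side p p∈I i))

    interior-component : ∀ {X : Pred ℙ² 0ℓ} → Interior ⊆ X →
      (∀ {q} → q ∈ X → ∀ i → side (rep q) i ≉ 0#) → IsConnectedComponent X Interior
    interior-component I⊆X sides≉0 = record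
      { respects  = λ {p} {q} → interior-respects {p} {q}
      ; nonempty  = interior-nonempty
      ; included  = I⊆X
      ; connected = interior-connected
      ; maximal   = λ C _ → interior-maximal sides≉0 C
      }

    -- A negative product of two side values persists on an open neighbourhood, which would have to
    -- meet `Interior`.
    closure⊆region : Closure Interior ⊆ region triangle
    closure⊆region {p} p∈cl = side-region p same
      where
      same : ∀ i j → 0# ≤ side (rep p) i * side (rep p) j
      same i j with sign (side (rep p) i * side (rep p) j)
      ... | positive s = inj₁ s
      ... | null s     = inj₂ (sym s)
      ... | negative s =
        let q , neg , q∈I = p∈cl _ (quadric-open (-³ l i) (l j)) (0<-resp (sym (flip p)) s)
        in contradiction (0<-resp (flip q) neg) (¬both-signs (interior-sides q q∈I i j))
        where
        flip : ∀ q → dot (-³ l i) (rep q) * side (rep q) j ≈ - (side (rep q) i * side (rep q) j)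
        flip q = trans (*-congʳ (dot-neg (l i) (rep q)))
          (solve 2 (λ a b → :- a :* b := :- (a :* b)) refl (side (rep q) i) (side (rep q) j))

    -- Adding the same small `h` > 0 to all coefficients makes them positive. This moves the
    -- representative by `h ·³ d`, so `h` is taken as half the radius allowed for the direction `d`.
    region⊆closure : region triangle ⊆ Closure Interior
    region⊆closure {p} (c , 0≤c , (k , k≉0 , e)) U openU p∈U = q , q∈U , q∈I
      where
      d = k ·³ combination (λ _ → 1#) corners
      ball = Open.interior openU p p∈U
      radius = displacement-near d (proj₁ (proj₂ ball))
      δ = proj₁ radius
      0<δ = proj₁ (proj₂ radius)
      ½ = proj₁ (recip (0<⇒≉ 0<2))
      ½2≈1 = proj₂ (recip (0<⇒≉ 0<2))
      h = δ * ½
      0<h : 0# < h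
      0<h = *-pos 0<δ (recip-pos 0<2 ½2≈1)
      0<δ-h : 0# < δ - h
      0<δ-h = 0<-resp
        (trans (solve 2 (λ δ ½ → δ :* ½ := δ :* (½ :* (:1 :+ :1)) :- δ :* ½) refl δ ½)
               (+-congʳ (trans (*-congˡ ½2≈1) (*-identityʳ δ)))) 0<h

      c′ : Fin 3 → ℝ
      c′ i = c i + h

      u = k ·³ combination c′ corners
      0<c′ : ∀ i → 0# < c′ i
      0<c′ i = +-nonneg-pos (0≤c i) 0<h

      side-u : ∀ i → side u i ≈ k * D * c′ i
      side-u = side-∼ {u} {c′} {k} ≈³-refl

      0<side-u : ∀ i j → 0# < side u i * side u j
      0<side-u i j = 0<-resp
        (trans (solve 4 (λ k D a b → k :* D :* (k :* D) :* (a :* b) := k :* D :* a :* (k :* D :* b))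
                 refl k D (c′ i) (c′ j))
               (sym (*-cong (side-u i) (side-u j))))
        (*-pos (sq-pos (*-≉0 k≉0 D≉0)) (*-pos (0<c′ i) (0<c′ j)))

      q : ℙ²
      q = [ u , (λ z → 0<⇒≉ (0<side-u 0F 0F) (trans (*-congʳ (dot-0³ (l 0F) z)) (zeroˡ _))) ]

      q∈I : q ∈ Interior
      q∈I = 0<side-u 0F 1F , 0<side-u 0F 2F

      shift : ∀ a b c x y z → k * ((a + h) * x + (b + h) * y + (c + h) * z) ≈
        k * (a * x + b * y + c * z) + h * (k * (1# * x + 1# * y + 1# * z))
      shift = solve 8 (λ k h a b c x y z →
        k :* ((a :+ h) :* x :+ (b :+ h) :* y :+ (c :+ h) :* z) :=
        k :* (a :* x :+ b :* y :+ c :* z) :+ h :* (k :* (:1 :* x :+ :1 :* y :+ :1 :* z)))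
        refl k h

      u≈ : u ≈³ rep p +³ h ·³ d
      u≈ = trans (shift _ _ _ _ _ _) (+-congʳ (sym (proj₁ e))) ,
           trans (shift _ _ _ _ _ _) (+-congʳ (sym (proj₁ (proj₂ e)))) ,
           trans (shift _ _ _ _ _ _) (+-congʳ (sym (proj₂ (proj₂ e))))

      q∈U : q ∈ U
      q∈U = proj₂ (proj₂ ball) q
        (proj₂ (proj₂ radius) {h} {rep p} {u} (+-pos 0<δ 0<h) 0<δ-h u≈)

    isCell : ∀ {S : List ℝ²} → Interior ⊆ Complement S →
      (∀ {q} → q ∈ Complement S → ∀ i → side (rep q) i ≉ 0#) → IsCell S (region triangle)
    isCell I⊆ sides≉0 = Interior , interior-component (λ {q} → I⊆ {q}) (λ {q} → sides≉0 {q}) , region⊆closure , closure⊆region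

-- Orientation, separation and dual lines.

module Duality (R : RealField) where
  open RealField R
  open Geometry R
  open OrderedField R
  open ℤ-Coefficients commutativeRing
  open Topology R
  open Cells R

  open Setoid ℝ²-setoid public using () renaming (sym to ≈²-sym)

  -- The coefficients of `L_p`, normalised so that the middle one is 1; this normalisation ties
  -- signs of forms to the vertical direction.
  covector : ℝ² → ℝ³
  covector (x , y) = - x , 1# , y

  covectorᴾ : ∀ {n} → Polynomial n → Polynomial n → Polynomial n × Polynomial n × Polynomial n
  covectorᴾ x y = :- x , :1 , y

  covector-cong : ∀ {p q} → p ≈² q → covector p ≈³ covector q
  covector-cong (e , f) = -‿cong e , refl , f

  ⋆⇒dot : ∀ p {q} → q ∈ p ⋆ → dot (covector p) (rep q) ≈ 0#
  ⋆⇒dot (px , py) {[ (x , y , w) , _ ]} e = trans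
    (solve 5 (λ px py x y w → P.dot (covectorᴾ px py) (x , y , w) := y :- (px :* x :- py :* w)) refl
      px py x y w)
    (trans (+-congʳ e) (-‿inverseʳ _))

  dot⇒⋆ : ∀ p {q} → dot (covector p) (rep q) ≈ 0# → q ∈ p ⋆
  dot⇒⋆ (px , py) {[ (x , y , w) , _ ]} e = trans
    (solve 5 (λ px py x y w → y := P.dot (covectorᴾ px py) (x , y , w) :+ (px :* x :- py :* w)) refl
      px py x y w)
    (trans (+-congʳ e) (+-identityˡ _))

  -- Twice the signed area of the triangle pqr, positive when it is counterclockwise.
  orient : ℝ² → ℝ² → ℝ² → ℝ
  orient p q r = det (covector p) (covector q) (covector r)

  det-cong : ∀ {u u′ v v′ w w′} → u ≈³ u′ → v ≈³ v′ → w ≈³ w′ → det u v w ≈ det u′ v′ w′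
  det-cong {u} {u′} {v} {v′} {w} {w′} (e₁ , e₂ , e₃) (f₁ , f₂ , f₃) =
    dot-cong {cross u v} {cross u′ v′} {w} {w′}
      (m e₂ e₃ f₂ f₃ , m e₃ e₁ f₃ f₁ , m e₁ e₂ f₁ f₂)
    where
    m : ∀ {a a′ b b′ c c′ d d′} → a ≈ a′ → b ≈ b′ → c ≈ c′ → d ≈ d′ →
        a * d - b * c ≈ a′ * d′ - b′ * c′
    m p q r s = +-cong (*-cong p s) (-‿cong (*-cong q r))

  det-swap₁₂ : ∀ a b c → det b a c ≈ - det a b c
  det-swap₁₂ (a₁ , a₂ , a₃) (b₁ , b₂ , b₃) (c₁ , c₂ , c₃) =
    solve 9 (λ a₁ a₂ a₃ b₁ b₂ b₃ c₁ c₂ c₃ →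
      let a = a₁ , a₂ , a₃; b = b₁ , b₂ , b₃; c = c₁ , c₂ , c₃ in
      P.det b a c := :- P.det a b c)
      refl a₁ a₂ a₃ b₁ b₂ b₃ c₁ c₂ c₃

  det-diagonal : ∀ a c → det a a c ≈ 0#
  det-diagonal (a₁ , a₂ , a₃) (c₁ , c₂ , c₃) =
    solve 6 (λ a₁ a₂ a₃ c₁ c₂ c₃ →
      P.det (a₁ , a₂ , a₃) (a₁ , a₂ , a₃) (c₁ , c₂ , c₃) := :0)
      refl a₁ a₂ a₃ c₁ c₂ c₃

  cramer : ∀ a b c p u → orient a b c * dot (covector p) u ≈
    orient p b c * dot (covector a) u + orient a p c * dot (covector b) u +
    orient a b p * dot (covector c) u
  cramer (a₁ , a₂) (b₁ , b₂) (c₁ , c₂) (p₁ , p₂) (x , y , w) =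
    solve 11 (λ a₁ a₂ b₁ b₂ c₁ c₂ p₁ p₂ x y w →
      let a = covectorᴾ a₁ a₂; b = covectorᴾ b₁ b₂; c = covectorᴾ c₁ c₂; p = covectorᴾ p₁ p₂
          u = x , y , w in
      P.det a b c :* P.dot p u :=
      P.det p b c :* P.dot a u :+ P.det a p c :* P.dot b u :+ P.det a b p :* P.dot c u)
      refl a₁ a₂ b₁ b₂ c₁ c₂ p₁ p₂ x y w

  x-y≈0⇒x≈y : ∀ {x y} → x - y ≈ 0# → x ≈ y
  x-y≈0⇒x≈y {x} {y} e = trans (solve 2 (λ x y → x := x :- y :+ y) refl x y)
    (trans (+-congʳ e) (+-identityˡ y))

  lineThrough : ∀ p q → p ≉² q → Line
  lineThrough (px , py) (qx , qy) p≉q = line (py - qy) (qx - px) (px * qy - py * qx)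
    λ (e , f) → p≉q (sym (x-y≈0⇒x≈y f) , x-y≈0⇒x≈y e)

  eval-lineThrough : ∀ p q (p≉q : p ≉² q) r → Line.eval (lineThrough p q p≉q) r ≈ orient p q r
  eval-lineThrough (px , py) (qx , qy) _ (rx , ry) = solve 6 (λ px py qx qy rx ry →
    (py :- qy) :* rx :+ (qx :- px) :* ry :+ (px :* qy :- py :* qx) :=
    P.det (covectorᴾ px py) (covectorᴾ qx qy) (covectorᴾ rx ry)) refl px py qx qy rx ry

  through₁ : ∀ p q (p≉q : p ≉² q) → Through (lineThrough p q p≉q) p
  through₁ (px , py) (qx , qy) _ = solve 4 (λ px py qx qy →
    (py :- qy) :* px :+ (qx :- px) :* py :+ (px :* qy :- py :* qx) := :0) refl px py qx qy

  through₂ : ∀ p q (p≉q : p ≉² q) → Through (lineThrough p q p≉q) q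
  through₂ (px , py) (qx , qy) _ = solve 4 (λ px py qx qy →
    (py :- qy) :* qx :+ (qx :- px) :* qy :+ (px :* qy :- py :* qx) := :0) refl px py qx qy

  orient-zero⇒collinear : ∀ {p q r} → p ≉² q → orient p q r ≈ 0# → Collinear p q r
  orient-zero⇒collinear {p} {q} {r} p≉q e = lineThrough p q p≉q , through₁ p q p≉q ,
    through₂ p q p≉q , trans (eval-lineThrough p q p≉q r) e

  orient⇒separates : ∀ {p q r s} → p ≉² q → 0# < - (orient p q r * orient p q s) →
    LineSeparates p q r s
  orient⇒separates {p} {q} {r} {s} p≉q neg =
    p≉q , ℓ , through₁ p q p≉q , through₂ p q p≉q , separates
    where
    ℓ = lineThrough p q p≉q
    er = eval-lineThrough p q p≉q r
    es = eval-lineThrough p q p≉q s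

    -0⇒ : ∀ {x} → 0# < - x → x < 0#
    -0⇒ p = 0<-⇒< (0<-resp (sym (+-identityˡ _)) p)

    separates : StrictlySeparates ℓ r s
    separates with sign (orient p q r)
    ... | positive o = inj₂ (<-respˡ-≈ (sym es) (-0⇒ (*-cancel-pos (inj₁ o) (0<-resp
            (solve 2 (λ x y → :- (x :* y) := x :* :- y) refl (orient p q r) (orient p q s)) neg))) ,
            0<-resp (sym er) o)
    ... | null o = contradiction (trans (-‿cong (trans (*-congʳ o) (zeroˡ (orient p q s))))
            -0#≈0#) (0<⇒≉ neg)
    ... | negative o = inj₁ (<-respˡ-≈ (sym er) (-0⇒ o) , 0<-resp (sym es)
            (*-cancel-pos (inj₁ o) (0<-resp
              (solve 2 (λ x y → :- (x :* y) := :- x :* y) refl (orient p q r) (orient p q s)) neg)))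

  -- Any line through `p` and `q` has an equation proportional to the orientation. Instead of
  -- extracting the factor, the proportionality is stated for each of α and β; adding the squared
  -- relations gives `key`, with positive factors on both sides.
  separates⇒orient : ∀ {p q r s} → LineSeparates p q r s → 0# < - (orient p q r * orient p q s)
  separates⇒orient {p} {q} {r} {s} (p≉q , ℓ@(line α β γ nd) , ep≈0 , eq≈0 , sep) =
    *-cancel-pos (inj₁ (≉0-sum-sq nd)) (0<-resp key (*-pos 0<dist (evals sep)))
    where
    px = proj₁ p
    py = proj₂ p
    qx = proj₁ q
    qy = proj₂ q
    E = Line.eval ℓ

    0<dist : 0# < (py - qy) * (py - qy) + (qx - px) * (qx - px)
    0<dist = ≉0-sum-sq λ (e , f) → p≉q (sym (x-y≈0⇒x≈y f) , x-y≈0⇒x≈y e)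

    evals : StrictlySeparates ℓ r s → 0# < - (E r * E s)
    evals (inj₁ (r<0 , 0<s)) = 0<-resp (solve 2 (λ x y → :- x :* y := :- (x :* y)) refl (E r) (E s))
      (*-pos (<0⇒0<- r<0) 0<s)
    evals (inj₂ (s<0 , 0<r)) = 0<-resp (solve 2 (λ x y → x :* :- y := :- (x :* y)) refl (E r) (E s))
      (*-pos 0<r (<0⇒0<- s<0))

    α-orient : ∀ t → α * orient p q t ≈ (py - qy) * E t
    α-orient (tx , ty) = trans
      -- The two sides differ by a combination of the values of the line's equation at `p` and `q`,
      -- which both vanish.
      (solve 9 (λ α β γ px py qx qy tx ty →
        α :* P.det (covectorᴾ px py) (covectorᴾ qx qy) (covectorᴾ tx ty) :=
        (α :* px :+ β :* py :+ γ) :* (qy :- ty) :+ (α :* qx :+ β :* qy :+ γ) :* (ty :- py) :+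
        (py :- qy) :* (α :* tx :+ β :* ty :+ γ)) refl α β γ px py qx qy tx ty)
      (trans (+-congʳ (trans (+-cong (trans (*-congʳ ep≈0) (zeroˡ _)) (trans (*-congʳ eq≈0) (zeroˡ _)))
        (+-identityˡ 0#))) (+-identityˡ _))

    β-orient : ∀ t → β * orient p q t ≈ (qx - px) * E t
    β-orient (tx , ty) = trans
      (solve 9 (λ α β γ px py qx qy tx ty →
        β :* P.det (covectorᴾ px py) (covectorᴾ qx qy) (covectorᴾ tx ty) :=
        (α :* px :+ β :* py :+ γ) :* (tx :- qx) :+ (α :* qx :+ β :* qy :+ γ) :* (px :- tx) :+
        (qx :- px) :* (α :* tx :+ β :* ty :+ γ)) refl α β γ px py qx qy tx ty)
      (trans (+-congʳ (trans (+-cong (trans (*-congʳ ep≈0) (zeroˡ _)) (trans (*-congʳ eq≈0) (zeroˡ _)))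
        (+-identityˡ 0#))) (+-identityˡ _))

    key : ((py - qy) * (py - qy) + (qx - px) * (qx - px)) * - (E r * E s) ≈
          (α * α + β * β) * - (orient p q r * orient p q s)
    key = trans
      (solve 4 (λ dy dx er es → (dy :* dy :+ dx :* dx) :* :- (er :* es) :=
         :- (dy :* er :* (dy :* es)) :- dx :* er :* (dx :* es)) refl (py - qy) (qx - px) (E r) (E s))
      (trans
        (+-cong (-‿cong (sym (*-cong (α-orient r) (α-orient s))))
                (-‿cong (sym (*-cong (β-orient r) (β-orient s)))))
        (solve 4 (λ α β x y → :- (α :* x :* (α :* y)) :- β :* x :* (β :* y) :=
          (α :* α :+ β :* β) :* :- (x :* y)) refl α β (orient p q r) (orient p q s)))

  _≈²?_ : ∀ p q → Dec (p ≈² q)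
  (x , y) ≈²? (x′ , y′) with compare x x′ | compare y y′
  ... | tri≈ _ e _ | tri≈ _ f _ = yes (e , f)
  ... | tri< _ n _ | _          = no λ z → n (proj₁ z)
  ... | tri> _ n _ | _          = no λ z → n (proj₁ z)
  ... | tri≈ _ _ _ | tri< _ n _ = no λ z → n (proj₂ z)
  ... | tri≈ _ _ _ | tri> _ n _ = no λ z → n (proj₂ z)

  det-swap₂₃ : ∀ a b c → det a c b ≈ - det a b c
  det-swap₂₃ a b c = trans (sym (det-cycle a c b)) (trans (det-swap₁₂ b c a) (-‿cong (det-cycle a b c)))

  -- Exchanging two points flips an orientation; this turns the separation of `b` from `c` by the
  -- line through `a` and `p` into BC > 0.
  separation-at-a : ∀ a b c p →
    - (orient a p b * orient a p c) ≈ orient a p c * orient a b p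
  separation-at-a a b c p = trans
    (-‿cong (*-congʳ (det-swap₂₃ (covector a) (covector b) (covector p))))
    (solve 2 (λ B C → :- (:- C :* B) := B :* C) refl (orient a p c) (orient a b p))

  separation-at-b : ∀ a b c p →
    - (orient b p a * orient b p c) ≈ orient p b c * orient a b p
  separation-at-b a b c p = trans
    (-‿cong (*-cong (det-cycle (covector a) (covector b) (covector p))
                    (det-swap₁₂ (covector p) (covector b) (covector c))))
    (solve 2 (λ A C → :- (C :* :- A) := A :* C) refl (orient p b c) (orient a b p))

  orient-diagonal : ∀ {p q} r → p ≈² q → orient p q r ≈ 0#
  orient-diagonal {p} {q} r e = trans
    (det-cong {covector p} {covector q} {covector q} {covector q} {covector r}
      (covector-cong e) ≈³-refl ≈³-refl)
    (det-diagonal (covector q) (covector r))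

  NoSeparation : ℝ² → ℝ² → ℝ² → ℝ² → Set
  NoSeparation a b c p =
    ¬ 0# < orient a p c * orient a b p × ¬ 0# < orient p b c * orient a b p

  -- When `p` coincides with `a` or `b` there may be no line to speak of, but then an orientation
  -- with a repeated point makes the product zero.
  exitEdge⇒noSeparation : ∀ {S a b c} → ExitEdge S a b c → ∀ {p} → p ∈ˢ S → NoSeparation a b c p
  exitEdge⇒noSeparation {S} {a} {b} {c} (na , nb) {p} p∈S =
    (λ pos → case a ≈²? p of λ where
      (yes e) → 0<⇒≉ pos (trans (*-congʳ (orient-diagonal c e)) (zeroˡ _))
      (no a≉p) → na (p , p∈S ,
        orient⇒separates a≉p (0<-resp (sym (separation-at-a a b c p)) pos))) ,
    (λ pos → case b ≈²? p of λ where
      (yes e) → 0<⇒≉ pos (trans (*-congʳ (orient-diagonal c (≈²-sym e))) (zeroˡ _))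
      (no b≉p) → nb (p , p∈S ,
        orient⇒separates b≉p (0<-resp (sym (separation-at-b a b c p)) pos)))

  noSeparation⇒exitEdge : ∀ {S a b c} → (∀ {p} → p ∈ˢ S → NoSeparation a b c p) → ExitEdge S a b c
  noSeparation⇒exitEdge {S} {a} {b} {c} none =
    (λ (p , p∈S , sep) → proj₁ (none p∈S)
      (0<-resp (separation-at-a a b c p) (separates⇒orient sep))) ,
    (λ (p , p∈S , sep) → proj₂ (none p∈S)
      (0<-resp (separation-at-b a b c p) (separates⇒orient sep)))

-- Directed sides and the sign of `turn`.

module Direction (R : RealField) where
  open RealField R
  open Geometry R
  open OrderedField R
  open ℤ-Coefficients commutativeRing
  open Topology R

  -- The sign of the derivative of the Euclidean abscissa along segment u v, and
  -- also the factor by which cross u v differs from the covector of its line.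
  turn : ℝ³ → ℝ³ → ℝ
  turn u v = proj₁ (proj₂ (cross u v))

  height : ℝ³ → ℝ
  height (_ , _ , w) = w

  height≉0⇒affine : ∀ u → height u ≉ 0# → ∃[ z ] u ∼ affine z
  height≉0⇒affine (x , y , w) w≉0 with recip w≉0
  ... | i , iw≈1 = (i * x , i * y) , w , w≉0 , coordinate x , coordinate y , sym (*-identityʳ w)
    where
    coordinate : ∀ x → x ≈ w * (i * x)
    coordinate x = trans (sym (*-identityˡ x)) (trans (*-congʳ (sym iw≈1))
      (solve 3 (λ i w x → i :* w :* x := w :* (i :* x)) refl i w x))

  affine⇒height≉0 : ∀ {u z} → u ∼ affine z → height u ≉ 0#
  affine⇒height≉0 (k , k≉0 , (_ , _ , e)) w≈0 = k≉0 (trans (sym (*-identityʳ k)) (trans (sym e) w≈0))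

  affine-abscissa : ∀ {u z} → u ∼ affine z → proj₁ u ≈ height u * proj₁ z
  affine-abscissa (k , k≉0 , (e , _ , f)) = trans e (*-congʳ (sym (trans f (*-identityʳ k))))

  -- The root of the linear interpolation is f / (f - g). Its bounds are proved after multiplication
  -- by (f - g)², since the sign of f - g is unknown.
  root-between : ∀ {f g} → 0# < - (f * g) →
    ∃[ λ₀ ] 0# ≤ λ₀ × λ₀ ≤ 1# × f + λ₀ * (g - f) ≈ 0#
  root-between {f} {g} neg = f * i , inj₁ 0<fi , inj₁ fi<1 , zero-at
    where
    0<f[f-g] : 0# < f * (f - g)
    0<f[f-g] = 0<-resp (solve 2 (λ f g → f :* f :+ :- (f :* g) := f :* (f :- g)) refl f g)
      (+-nonneg-pos (sq-nonneg f) neg)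
    f-g≉0 = *-≉0ʳ (0<⇒≉ 0<f[f-g])
    i = proj₁ (recip f-g≉0)
    i-inverse = proj₂ (recip f-g≉0)

    0<fi : 0# < f * i
    0<fi = *-cancel-pos (sq-nonneg (f - g)) (0<-resp
      (sym (trans (solve 3 (λ f i d → d :* d :* (f :* i) := f :* d :* (i :* d)) refl f i (f - g))
        (trans (*-congˡ i-inverse) (*-identityʳ _)))) 0<f[f-g])

    fi<1 : f * i < 1#
    fi<1 = 0<-⇒< (*-cancel-pos (sq-nonneg (f - g)) (0<-resp
      (sym (trans
        (solve 3 (λ f g i → let d = f :- g in d :* d :* (:1 :- f :* i) :=
          d :* d :- f :* d :* (i :* d)) refl f g i)
        (trans (+-congˡ (-‿cong (trans (*-congˡ i-inverse) (*-identityʳ _))))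
          (solve 2 (λ f g → (f :- g) :* (f :- g) :- f :* (f :- g) := :- (f :* g) :+ g :* g) refl f g))))
      (+-pos-nonneg neg (sq-nonneg g))))

    zero-at : f + f * i * (g - f) ≈ 0#
    zero-at = trans
      (solve 3 (λ f g i → f :+ f :* i :* (g :- f) := f :- f :* (i :* (f :- g))) refl f g i)
      (trans (+-congˡ (-‿cong (trans (*-congˡ i-inverse) (*-identityʳ f)))) (-‿inverseʳ f))

  module _ (u v : ℝ³) where
    private
      H : ℝ → ℝ
      H t = height (segment u v t)

      height-interpolation : ∀ s t l → H (s + l * (t - s)) ≈ H s + l * (H t - H s)
      height-interpolation s t l = solve 5 (λ a b s t l →
        let h = λ t → (:1 :- t) :* a :+ t :* b in
        h (s :+ l :* (t :- s)) := h s :+ l :* (h t :- h s)) refl (height u) (height v) s t l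

    -- The height is affine along the segment, so a change of sign would produce a point at infinity
    -- in between.
    same-height-sign : ∀ {s t} → s < t → (∀ r → s ≤ r → r ≤ t → H r ≉ 0#) → 0# < H s * H t
    same-height-sign {s} {t} s<t H≉0 with sign (H s * H t)
    ... | positive p = p
    ... | null e = contradiction e (*-≉0 (H≉0 s (inj₂ refl) (inj₁ s<t)) (H≉0 t (inj₁ s<t) (inj₂ refl)))
    ... | negative n =
      let l , 0≤l , l≤1 , root = root-between n
      in contradiction (trans (height-interpolation s t l) root) (H≉0 (s + l * (t - s))
        (0≤-⇒≤ (0≤-resp (solve 3 (λ s t l → l :* (t :- s) := s :+ l :* (t :- s) :- s) refl s t l)
          (*-nonneg 0≤l (inj₁ (<⇒0<- s<t)))))
        (0≤-⇒≤ (0≤-resp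
          (solve 3 (λ s t l → (:1 :- l) :* (t :- s) := t :- (s :+ l :* (t :- s))) refl s t l)
          (*-nonneg (≤⇒0≤- l≤1) (inj₁ (<⇒0<- s<t))))))

    -- The Euclidean abscissa is the first coordinate divided by the height; this is the difference
    -- of two such quotients with denominators cleared.
    abscissa-difference : ∀ {s t p q} → segment u v s ∼ affine p → segment u v t ∼ affine q →
      H s * H t * (proj₁ q - proj₁ p) ≈ (t - s) * turn u v
    abscissa-difference {s} {t} {p} {q} es et = trans
      (solve 4 (λ hs ht px qx → hs :* ht :* (qx :- px) := hs :* (ht :* qx) :- ht :* (hs :* px)) refl
        (H s) (H t) (proj₁ p) (proj₁ q))
      (trans (+-cong (*-congˡ (sym (affine-abscissa et))) (-‿cong (*-congˡ (sym (affine-abscissa es)))))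
        (solve 6 (λ ux uw vx vw s t →
          let c = λ a b t → (:1 :- t) :* a :+ t :* b in
          c uw vw s :* c ux vx t :- c uw vw t :* c ux vx s :=
          (t :- s) :* (uw :* vx :- ux :* vw)) refl
          (proj₁ u) (height u) (proj₁ v) (height v) s t))

    turn⇒directed : 0# < turn u v → Directed u v
    turn⇒directed pos {s} {t} _ s<t _ affine-on es et = 0<-⇒< (*-cancel-pos
      (inj₁ (same-height-sign s<t (λ r a b → affine⇒height≉0 (proj₂ (affine-on r a b)))))
      (0<-resp (sym (abscissa-difference es et)) (*-pos (<⇒0<- s<t) pos)))

    directed-stretch⇒turn : ∀ {s t} → 0# ≤ s → s < t → t ≤ 1# →
      (∀ r → s ≤ r → r ≤ t → H r ≉ 0#) → Directed u v → 0# < turn u v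
    directed-stretch⇒turn {s} {t} 0≤s s<t t≤1 H≉0 dir =
      let affine-on = λ r a b → height≉0⇒affine (segment u v r) (H≉0 r a b)
          p , es = affine-on s (inj₂ refl) (inj₁ s<t)
          q , et = affine-on t (inj₁ s<t) (inj₂ refl)
      in *-cancel-pos (inj₁ (<⇒0<- s<t)) (0<-resp (abscissa-difference es et)
           (*-pos (same-height-sign s<t H≉0)
             (<⇒0<- (dir 0≤s s<t t≤1 affine-on es et))))

    -- It suffices to find one stretch of the side without points at infinity. If the side starts at
    -- infinity, then its end does not, as `turn u v` is nonzero, and the second half serves;
    -- otherwise a short stretch at the start does.
    directed⇒turn : turn u v ≉ 0# → Directed u v → 0# < turn u v
    directed⇒turn turn≉0 dir = case ≈0? (height u) of λ where
        (yes uw≈0) → end uw≈0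
        (no uw≉0)  → start uw≉0
      where
      a = height u
      b = height v

      ≈0? : ∀ x → Dec (x ≈ 0#)
      ≈0? x with sign x
      ... | positive p = no (0<⇒≉ p)
      ... | null e     = yes e
      ... | negative p = no λ e → 0<⇒≉ p (trans (-‿cong e)
                           -0#≈0#)

      end : a ≈ 0# → 0# < turn u v
      end a≈0 = directed-stretch⇒turn (inj₁ 0<½) ½<1 (inj₂ refl)
          (λ r ½≤r _ e → *-≉0 (0<⇒≉ (0<r ½≤r)) b≉0 (trans (sym (trans
            (+-congʳ (trans (*-congˡ a≈0) (zeroʳ _))) (+-identityˡ _))) e)) dir
        where
        ½ = proj₁ (recip (0<⇒≉ 0<2))
        ½2≈1 = proj₂ (recip (0<⇒≉ 0<2))
        0<½ = recip-pos 0<2 ½2≈1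
        ½<1 : ½ < 1#
        ½<1 = 0<-⇒< (0<-resp (trans (solve 1 (λ h → h := h :* (:1 :+ :1) :- h) refl ½)
          (+-congʳ ½2≈1)) 0<½)
        0<r : ∀ {r} → ½ ≤ r → 0# < r
        0<r (inj₁ p) = <-trans 0<½ p
        0<r (inj₂ e) = 0<-resp e 0<½
        b≉0 : b ≉ 0#
        b≉0 b≈0 = turn≉0 (trans (+-cong (*-congʳ a≈0) (-‿cong (*-congˡ b≈0)))
          (solve 2 (λ x y → :0 :* x :- y :* :0 := :0) refl (proj₁ v) (proj₁ u)))

      start : a ≉ 0# → 0# < turn u v
      start a≉0 = directed-stretch⇒turn (inj₂ refl) 0<τ (inj₁ τ<1)
          (λ r 0≤r r≤τ → *-≉0ʳ (*-≉0ʳ (0<⇒≉ (0<2aH 0≤r r≤τ)))) dir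
        where
        d = b - a
        M = a * a + a * a + d * d
        0<M : 0# < M
        0<M = +-pos-nonneg (+-pos (sq-pos a≉0) (sq-pos a≉0)) (sq-nonneg d)
        i = proj₁ (recip (0<⇒≉ 0<M))
        iM≈1 = proj₂ (recip (0<⇒≉ 0<M))
        -- So small that the height keeps the sign of a on [0, τ].
        τ = a * a * i
        τM≈a² : τ * M ≈ a * a
        τM≈a² = trans (*-assoc _ i M) (trans (*-congˡ iM≈1) (*-identityʳ _))
        0<τ : 0# < τ
        0<τ = *-pos (sq-pos a≉0) (recip-pos 0<M iM≈1)
        τ<1 : τ < 1#
        τ<1 = 0<-⇒< (*-cancel-pos (inj₁ 0<M) (0<-resp
          (sym (trans (solve 2 (λ τ M → M :* (:1 :- τ) := M :- τ :* M) refl τ M)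
            (trans (+-congˡ (-‿cong τM≈a²))
              (solve 2 (λ a d → a :* a :+ a :* a :+ d :* d :- a :* a := a :* a :+ d :* d) refl a d))))
          (+-pos-nonneg (sq-pos a≉0) (sq-nonneg d))))

        0<2aH : ∀ {r} → 0# ≤ r → r ≤ τ → 0# < (1# + 1#) * (a * H r)
        0<2aH {r} 0≤r r≤τ = 0<-resp
          -- Using `τ * M` ≈ a², twice a times the height becomes a sum of terms that are
          -- nonnegative on [0, τ], with a² > 0 among them.
          (trans
            (solve 4 (λ a b r τ → let d = b :- a; M = a :* a :+ a :* a :+ d :* d in
              a :* a :+ r :* (a :* a) :+ (τ :- r) :* M :+ r :* (b :* b) :=
              (:1 :+ :1) :* (a :* ((:1 :- r) :* a :+ r :* b)) :+ (τ :* M :- a :* a)) refl a b r τ)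
            (trans (+-congˡ (trans (+-congʳ τM≈a²) (-‿inverseʳ _))) (+-identityʳ _)))
          (+-pos-nonneg (+-pos-nonneg (+-pos-nonneg (sq-pos a≉0) (*-nonneg 0≤r (sq-nonneg a)))
            (*-nonneg (≤⇒0≤- r≤τ) (inj₁ 0<M))) (*-nonneg 0≤r (sq-nonneg b)))

-- Triangles whose sides lie on dual lines.

module TriangularCell (R : RealField) where
  open RealField R
  open Geometry R
  open OrderedField R
  open ℤ-Coefficients commutativeRing
  open Topology R
  open Cells R
  open Duality R
  open Direction R

  -- Settled by deciding all quadruples of indices; the inequalities are first moved into the
  -- disjunction as equalities.
  three-indices : ∀ (i j k n : Fin 3) → i ≢ j → i ≢ k → j ≢ k → n ≡ i ⊎ n ≡ j ⊎ n ≡ k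
  three-indices i j k n i≢j i≢k j≢k with toWitness {a? =
    Fin.all? λ i → Fin.all? λ j → Fin.all? λ k → Fin.all? λ n →
      (i Fin.≟ j) ⊎-dec (i Fin.≟ k) ⊎-dec (j Fin.≟ k) ⊎-dec
      (n Fin.≟ i) ⊎-dec (n Fin.≟ j) ⊎-dec (n Fin.≟ k)} _ i j k n
  ... | inj₁ e = contradiction e i≢j
  ... | inj₂ (inj₁ e) = contradiction e i≢k
  ... | inj₂ (inj₂ (inj₁ e)) = contradiction e j≢k
  ... | inj₂ (inj₂ (inj₂ c)) = c

  cramer³ : ∀ u v w q →
    det u v w ·³ q ≈³ det q v w ·³ u +³ det u q w ·³ v +³ det u v q ·³ w
  cramer³ (u₁ , u₂ , u₃) (v₁ , v₂ , v₃) (w₁ , w₂ , w₃) (q₁ , q₂ , q₃) =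
      solve 12 (λ u₁ u₂ u₃ v₁ v₂ v₃ w₁ w₂ w₃ q₁ q₂ q₃ →
        let u = u₁ , u₂ , u₃; v = v₁ , v₂ , v₃; w = w₁ , w₂ , w₃; q = q₁ , q₂ , q₃ in
        P.det u v w :* q₁ := P.det q v w :* u₁ :+ P.det u q w :* v₁ :+ P.det u v q :* w₁)
        refl u₁ u₂ u₃ v₁ v₂ v₃ w₁ w₂ w₃ q₁ q₂ q₃
    , solve 12 (λ u₁ u₂ u₃ v₁ v₂ v₃ w₁ w₂ w₃ q₁ q₂ q₃ →
        let u = u₁ , u₂ , u₃; v = v₁ , v₂ , v₃; w = w₁ , w₂ , w₃; q = q₁ , q₂ , q₃ in
        P.det u v w :* q₂ := P.det q v w :* u₂ :+ P.det u q w :* v₂ :+ P.det u v q :* w₂)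
        refl u₁ u₂ u₃ v₁ v₂ v₃ w₁ w₂ w₃ q₁ q₂ q₃
    , solve 12 (λ u₁ u₂ u₃ v₁ v₂ v₃ w₁ w₂ w₃ q₁ q₂ q₃ →
        let u = u₁ , u₂ , u₃; v = v₁ , v₂ , v₃; w = w₁ , w₂ , w₃; q = q₁ , q₂ , q₃ in
        P.det u v w :* q₃ := P.det q v w :* u₃ :+ P.det u q w :* v₃ :+ P.det u v q :* w₃)
        refl u₁ u₂ u₃ v₁ v₂ v₃ w₁ w₂ w₃ q₁ q₂ q₃

  -- For `u` and `v` on the dual line of `p`, the vector `cross u v` is a multiple of `covector p`;
  -- the factor is its middle coordinate, because that of the covector is 1.
  det-on-line : ∀ p u v w → dot (covector p) u ≈ 0# → dot (covector p) v ≈ 0# →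
    det u v w ≈ turn u v * dot (covector p) w
  det-on-line (a , b) (u₁ , u₂ , u₃) (v₁ , v₂ , v₃) (w₁ , w₂ , w₃) e f = trans
    (solve 11 (λ a b u₁ u₂ u₃ v₁ v₂ v₃ w₁ w₂ w₃ →
      let l = covectorᴾ a b; u = u₁ , u₂ , u₃; v = v₁ , v₂ , v₃; w = w₁ , w₂ , w₃ in
      P.det u v w := (u₃ :* v₁ :- u₁ :* v₃) :* P.dot l w :+
        (P.dot l u :* (v₃ :* w₁ :- v₁ :* w₃) :+ P.dot l v :* (u₁ :* w₃ :- u₃ :* w₁)))
      refl a b u₁ u₂ u₃ v₁ v₂ v₃ w₁ w₂ w₃)
    (trans (+-congˡ (trans (+-cong (trans (*-congʳ e) (zeroˡ _)) (trans (*-congʳ f) (zeroˡ _)))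
      (+-identityˡ 0#))) (+-identityʳ _))

  -- The values of `l` and `m` show that `u` and `v` are independent: by the Binet identity,
  -- (l·u)(m·v) would vanish together with `turn u v`.
  turn≉0 : ∀ p u v l m → dot (covector p) u ≈ 0# → dot (covector p) v ≈ 0# →
    dot l u ≉ 0# → dot l v ≈ 0# → dot m v ≉ 0# → turn u v ≉ 0#
  turn≉0 p u v l m pu pv lu lv mv turn≈0 = *-≉0 lu mv (trans
    (binet u v l m)
    (trans (+-cong (trans (det-on-line p u v (cross l m) pu pv) (trans (*-congʳ turn≈0) (zeroˡ _)))
                   (trans (*-congʳ lv) (zeroˡ _)))
           (+-identityˡ 0#)))
    where
    binet : ∀ u v l m → dot l u * dot m v ≈ det u v (cross l m) + dot l v * dot m u
    binet (u₁ , u₂ , u₃) (v₁ , v₂ , v₃) (l₁ , l₂ , l₃) (m₁ , m₂ , m₃) =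
      solve 12 (λ u₁ u₂ u₃ v₁ v₂ v₃ l₁ l₂ l₃ m₁ m₂ m₃ →
        let u = u₁ , u₂ , u₃; v = v₁ , v₂ , v₃; l = l₁ , l₂ , l₃; m = m₁ , m₂ , m₃ in
        P.dot l u :* P.dot m v := P.det u v (P.cross l m) :+ P.dot l v :* P.dot m u)
        refl u₁ u₂ u₃ v₁ v₂ v₃ l₁ l₂ l₃ m₁ m₂ m₃

  vertical : ℝ³
  vertical = 0# , 1# , 0#

  covector-vertical : ∀ p → dot (covector p) vertical ≈ 1#
  covector-vertical (x , y) = solve 2 (λ x y →
    P.dot (covectorᴾ x y) (:0 , :1 , :0) := :1) refl x y

  -- Coordinates and sides of an arbitrary triangle.

  module TriangleProperties (Δ : Triangle) where
    private
      v : Fin 3 → ℝ³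
      v = corner Δ

    D : ℝ
    D = det (v 0F) (v 1F) (v 2F)

    -- The coordinates with respect to the corners given by Cramer's rule, multiplied by `D`.
    coordinates : ℝ³ → Fin 3 → ℝ
    coordinates q 0F = det q (v 1F) (v 2F)
    coordinates q 1F = det (v 0F) q (v 2F)
    coordinates q 2F = det (v 0F) (v 1F) q

    spanning : ∀ q → D ·³ q ≈³ combination (coordinates q) v
    spanning = cramer³ (v 0F) (v 1F) (v 2F)

    -- If `D` vanished, independence applied to Cramer's relation would make the cross product of
    -- corners `0F` and `1F` zero. For each coordinate s of the first and t of the second, t times
    -- the first minus s times the second would then be zero, so independence would give s ≈ 0 for
    -- every coordinate of a nonzero vector.
    D≉0 : D ≉ 0#
    D≉0 D≈0 = nonzero (vertex Δ 0F)
        ( component x x′ (commute x x′) (trans (*-comm x′ y) (sym xy′≈yx′)) (trans (*-comm x′ w) wx′≈xw′)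
        , component y y′ (trans (*-comm y′ x) xy′≈yx′) (commute y y′) (trans (*-comm y′ w) (sym yw′≈wy′))
        , component w w′ (trans (*-comm w′ x) (sym wx′≈xw′)) (trans (*-comm w′ y) yw′≈wy′) (commute w w′) )
      where
      x = proj₁ (v 0F)
      y = proj₁ (proj₂ (v 0F))
      w = proj₂ (proj₂ (v 0F))
      x′ = proj₁ (v 1F)
      y′ = proj₁ (proj₂ (v 1F))
      w′ = proj₂ (proj₂ (v 1F))

      commute : ∀ s t → t * s ≈ s * t
      commute s t = *-comm t s

      vanish : ∀ q → det (v 0F) (v 1F) q ≈ 0#
      vanish q = Triangle.independent Δ (coordinates q)
        (≈³-trans (≈³-sym (spanning q)) (D·q≈0 , D·q≈0 , D·q≈0)) 2F
        where
        D·q≈0 : ∀ {t} → D * t ≈ 0#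
        D·q≈0 {t} = trans (*-congʳ D≈0) (zeroˡ t)

      yw′≈wy′ : y * w′ ≈ w * y′
      yw′≈wy′ = x-y≈0⇒x≈y (trans
        (solve 3 (λ a b c → a := a :* :1 :+ b :* :0 :+ c :* :0) refl _ _ _)
        (vanish (1# , 0# , 0#)))
      wx′≈xw′ : w * x′ ≈ x * w′
      wx′≈xw′ = x-y≈0⇒x≈y (trans
        (solve 3 (λ a b c → b := a :* :0 :+ b :* :1 :+ c :* :0) refl _ _ _)
        (vanish (0# , 1# , 0#)))
      xy′≈yx′ : x * y′ ≈ y * x′
      xy′≈yx′ = x-y≈0⇒x≈y (trans
        (solve 3 (λ a b c → c := a :* :0 :+ b :* :0 :+ c :* :1) refl _ _ _)
        (vanish (0# , 0# , 1#)))

      component : ∀ s t → t * x ≈ s * x′ → t * y ≈ s * y′ → t * w ≈ s * w′ → s ≈ 0#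
      component s t e f g = trans (sym (-‿involutive s)) (trans
        (-‿cong (Triangle.independent Δ (λ { 0F → t ; 1F → - s ; 2F → 0# })
          (relation e , relation f , relation g) 1F))
        -0#≈0#)
        where
        relation : ∀ {a b c} → t * a ≈ s * b → t * a + - s * b + 0# * c ≈ 0#
        relation {a} {b} {c} e = trans (+-cong (+-congʳ e) (zeroˡ c)) (solve 2 (λ s b →
          s :* b :+ :- s :* b :+ :0 := :0) refl s b)

    unit : Fin 3 → Fin 3 → ℝ
    unit 0F 0F = 1#
    unit 1F 1F = 1#
    unit 2F 2F = 1#
    unit _  _  = 0#

    unit-nonneg : ∀ i j → 0# ≤ unit i j
    unit-nonneg 0F 0F = inj₁ 0<1
    unit-nonneg 0F 1F = inj₂ refl
    unit-nonneg 0F 2F = inj₂ refl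
    unit-nonneg 1F 0F = inj₂ refl
    unit-nonneg 1F 1F = inj₁ 0<1
    unit-nonneg 1F 2F = inj₂ refl
    unit-nonneg 2F 0F = inj₂ refl
    unit-nonneg 2F 1F = inj₂ refl
    unit-nonneg 2F 2F = inj₁ 0<1

    unit-≢ : ∀ i j → i ≢ j → unit i j ≈ 0#
    unit-≢ 0F 0F n = contradiction ≡.refl n
    unit-≢ 0F 1F n = refl
    unit-≢ 0F 2F n = refl
    unit-≢ 1F 0F n = refl
    unit-≢ 1F 1F n = contradiction ≡.refl n
    unit-≢ 1F 2F n = refl
    unit-≢ 2F 0F n = refl
    unit-≢ 2F 1F n = refl
    unit-≢ 2F 2F n = contradiction ≡.refl n

    combination-unit : ∀ i → v i ≈³ combination (unit i) v
    combination-unit 0F = e _ _ _ , e _ _ _ , e _ _ _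
      where e = solve 3 (λ x y z → x := :1 :* x :+ :0 :* y :+ :0 :* z) refl
    combination-unit 1F = e _ _ _ , e _ _ _ , e _ _ _
      where e = solve 3 (λ x y z → y := :0 :* x :+ :1 :* y :+ :0 :* z) refl
    combination-unit 2F = e _ _ _ , e _ _ _ , e _ _ _
      where e = solve 3 (λ x y z → z := :0 :* x :+ :0 :* y :+ :1 :* z) refl

    vertex∈region : ∀ i → region Δ (vertex Δ i)
    vertex∈region i = unit i , unit-nonneg i , ≈³⇒∼ (combination-unit i)

    vertex∈side : ∀ {i j} → i ≢ j → sideOpposite Δ j (vertex Δ i)
    vertex∈side {i} {j} i≢j = unit i , unit-nonneg i , unit-≢ i j i≢j , ≈³⇒∼ (combination-unit i)

    dot-combination-opposite : ∀ l k c → (∀ n → n ≢ k → dot l (v n) ≈ 0#) →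
      dot l (combination c v) ≈ c k * dot l (v k)
    dot-combination-opposite l 0F c z = trans (dot-combination l c v) (trans
      (+-cong (+-congˡ (trans (*-congˡ (z 1F λ ())) (zeroʳ _))) (trans (*-congˡ (z 2F λ ())) (zeroʳ _)))
      (trans (+-identityʳ _) (+-identityʳ _)))
    dot-combination-opposite l 1F c z = trans (dot-combination l c v) (trans
      (+-cong (+-congʳ (trans (*-congˡ (z 0F λ ())) (zeroʳ _))) (trans (*-congˡ (z 2F λ ())) (zeroʳ _)))
      (trans (+-identityʳ _) (+-identityˡ _)))
    dot-combination-opposite l 2F c z = trans (dot-combination l c v) (trans
      (+-congʳ (+-cong (trans (*-congˡ (z 0F λ ())) (zeroʳ _)) (trans (*-congˡ (z 1F λ ())) (zeroʳ _))))
      (trans (+-congʳ (+-identityʳ _)) (+-identityˡ _)))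

    module Side {e k} (side⊆ : sideOpposite Δ k ⊆ e ⋆) where
      l = covector e

      vanishes : ∀ n → n ≢ k → dot l (v n) ≈ 0#
      vanishes n n≢k = ⋆⇒dot e {vertex Δ n} (side⊆ {vertex Δ n} (vertex∈side n≢k))

      opposite : ∀ {q c m} → q ≈³ m ·³ combination c v → dot l q ≈ m * (c k * dot l (v k))
      opposite {q} {c} {m} q≈ = trans (dot-cong {l} {l} {q} ≈³-refl q≈)
        (trans (dot-· l m (combination c v)) (*-congˡ (dot-combination-opposite l k c vanishes)))

      spanning-opposite : ∀ q → D * dot l q ≈ coordinates q k * dot l (v k)
      spanning-opposite q = trans (sym (dot-· l D q))
        (trans (dot-cong {l} {l} {D ·³ q} ≈³-refl (spanning q))
          (dot-combination-opposite l k (coordinates q) vanishes))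

      -- The form already vanishes at the other two corners. Vanishing at the third as well, it
      -- would be zero everywhere, yet its value at the vertical point is 1.
      nonvanishing : dot l (v k) ≉ 0#
      nonvanishing z = D≉0 (trans (sym (*-identityʳ D)) (trans (*-congˡ (sym (covector-vertical e)))
        (trans (spanning-opposite vertical) (trans (*-congˡ z) (zeroʳ _)))))

    sides-differ : ∀ {e j k} → j ≢ k → sideOpposite Δ j ⊆ e ⋆ → ¬ (sideOpposite Δ k ⊆ e ⋆)
    sides-differ {e} {j} {k} j≢k ⊆j ⊆k =
      Side.nonvanishing {e} {k} (λ {q} → ⊆k {q}) (Side.vanishes {e} {j} (λ {q} → ⊆j {q}) k (λ e → j≢k (≡.sym e)))

    module OpposedSides {i j k} (i≢j : i ≢ j) (i≢k : i ≢ k) (j≢k : j ≢ k) {e f c}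
      (k⊆e : sideOpposite Δ k ⊆ e ⋆) (j⊆f : sideOpposite Δ j ⊆ f ⋆) (i⊆c : sideOpposite Δ i ⊆ c ⋆)
      (j→i : Directed (v j) (v i)) (i→k : Directed (v i) (v k))
      (vertical∉ : ¬ region Δ verticalInfinity) where
      private
        module E = Side {e} {k} (λ {q} → k⊆e {q})
        module F = Side {f} {j} (λ {q} → j⊆f {q})
        module C = Side {c} {i} (λ {q} → i⊆c {q})

        j≢i : j ≢ i
        j≢i z = i≢j (≡.sym z)
        k≢i : k ≢ i
        k≢i z = i≢k (≡.sym z)
        k≢j : k ≢ j
        k≢j z = j≢k (≡.sym z)

        Θ = det (v j) (v i) (v k)

        -- By cyclic symmetry the determinant factors once for each side, as the turn of the side
        -- times the value of its form at the opposite corner.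
        Θ-e : Θ ≈ turn (v j) (v i) * dot E.l (v k)
        Θ-e = det-on-line e (v j) (v i) (v k) (E.vanishes j j≢k) (E.vanishes i i≢k)
        Θ-f : Θ ≈ turn (v i) (v k) * dot F.l (v j)
        Θ-f = trans (sym (det-cycle (v j) (v i) (v k)))
          (det-on-line f (v i) (v k) (v j) (F.vanishes i i≢j) (F.vanishes k k≢j))
        Θ-c : Θ ≈ turn (v k) (v j) * dot C.l (v i)
        Θ-c = trans (det-cycle (v k) (v j) (v i))
          (det-on-line c (v k) (v j) (v i) (C.vanishes k k≢i) (C.vanishes j j≢i))

        0<ji : 0# < turn (v j) (v i)
        0<ji = directed⇒turn (v j) (v i)
          (turn≉0 e (v j) (v i) F.l C.l (E.vanishes j j≢k) (E.vanishes i i≢k)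
            F.nonvanishing (F.vanishes i i≢j) C.nonvanishing) j→i

        0<ik : 0# < turn (v i) (v k)
        0<ik = directed⇒turn (v i) (v k)
          (turn≉0 f (v i) (v k) C.l E.l (F.vanishes i i≢j) (F.vanishes k k≢j)
            C.nonvanishing (C.vanishes k k≢i) E.nonvanishing) i→k

        kj≉0 : turn (v k) (v j) ≉ 0#
        kj≉0 = turn≉0 c (v k) (v j) E.l F.l (C.vanishes k k≢i) (C.vanishes j j≢i)
          E.nonvanishing (E.vanishes j j≢k) F.nonvanishing

        Θ≉0 : Θ ≉ 0#
        Θ≉0 z = *-≉0 kj≉0 C.nonvanishing (trans (sym Θ-c) z)

        -- If all three turns are positive, each coordinate of the vertical point, multiplied by D
        -- Θ, equals a turn times D². The coordinates then share a sign, which places the point in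
        -- the triangle.
        directed-cycle⇒vertical : 0# < turn (v k) (v j) → region Δ verticalInfinity
        directed-cycle⇒vertical 0<kj = (λ n → D * Θ * coordinates vertical n) , nonneg ,
          ∼-combination (coordinates vertical) v D≉0 (*-≉0 D≉0 Θ≉0) (spanning vertical)
          where
          scaled : ∀ {τ L s t} → 0# < τ → Θ ≈ τ * L → t ≈ 1# → D * t ≈ s * L → 0# ≤ D * Θ * s
          scaled {τ} {L} {s} {t} 0<τ Θ≈ t≈1 Dt≈ = inj₁ (0<-resp
            (sym (trans (*-congʳ (*-congˡ Θ≈))
              (trans (solve 4 (λ D τ L s → D :* (τ :* L) :* s := τ :* (D :* (s :* L))) refl D τ L s)
                (*-congˡ (*-congˡ (trans (sym Dt≈) (trans (*-congˡ t≈1) (*-identityʳ D))))))))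
            (*-pos 0<τ (sq-pos D≉0)))

          nonneg : ∀ n → 0# ≤ D * Θ * coordinates vertical n
          nonneg n with three-indices i j k n i≢j i≢k j≢k
          ... | inj₁ ≡.refl =
            scaled 0<kj Θ-c (covector-vertical c) (C.spanning-opposite vertical)
          ... | inj₂ (inj₁ ≡.refl) =
            scaled 0<ik Θ-f (covector-vertical f) (F.spanning-opposite vertical)
          ... | inj₂ (inj₂ ≡.refl) =
            scaled 0<ji Θ-e (covector-vertical e) (E.spanning-opposite vertical)

        0<jk : 0# < - turn (v k) (v j)
        0<jk with sign (turn (v k) (v j))
        ... | positive p = contradiction (directed-cycle⇒vertical p) vertical∉
        ... | null z     = contradiction z kj≉0
        ... | negative n = n

        -- Multiplying two factorisations of Θ gives the positive number Θ², while one turn in the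
        -- product is positive and the other negative.
        opposite-signs : ∀ {τ L} → 0# < τ → Θ ≈ τ * L → 0# < - (L * dot C.l (v i))
        opposite-signs {τ} {L} 0<τ Θ≈ = *-cancel-pos (inj₁ (*-pos 0<τ 0<jk)) (0<-resp
          (trans (*-cong Θ≈ Θ-c)
            (solve 4 (λ τ L σ M → τ :* L :* (σ :* M) := τ :* :- σ :* :- (L :* M)) refl
              τ L (turn (v k) (v j)) (dot C.l (v i))))
          (sq-pos Θ≉0))

      opposed-e : 0# < - (dot E.l (v k) * dot C.l (v i))
      opposed-e = opposite-signs 0<ji Θ-e

      opposed-f : 0# < - (dot F.l (v j) * dot C.l (v i))
      opposed-f = opposite-signs 0<ik Θ-f

-- From a triangular cell to the absence of separations.

module ExitEdges (R : RealField) where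
  open RealField R
  open Geometry R
  open OrderedField R
  open ℤ-Coefficients commutativeRing
  open Topology R
  open Cells R
  open Duality R
  open TriangularCell R

  matching-sign : ∀ {D P E M} → E ≉ 0# → M ≉ 0# → D * P ≈ E * M → 0# < P * (D * E * M)
  matching-sign {D} {P} {E} {M} E≉0 M≉0 e = 0<-resp
    (trans (*-congʳ (sym e))
      (solve 4 (λ D P E M → D :* P :* (E :* M) := P :* (D :* E :* M)) refl D P E M))
    (sq-pos (*-≉0 E≉0 M≉0))

  -- The product of the three positive quantities is the goal times (B b)².
  opposite-sign : ∀ {D B C P b c} → 0# < P * (D * B * b) → 0# < - (b * c) → 0# < B * C →
    0# < - (P * (D * C * c))
  opposite-sign {D} {B} {C} {P} {b} {c} p q r = *-cancel-pos (sq-nonneg (B * b)) (0<-resp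
    (solve 6 (λ D B C p b c → p :* (D :* B :* b) :* :- (b :* c) :* (B :* C) :=
      B :* b :* (B :* b) :* :- (p :* (D :* C :* c))) refl D B C P b c)
    (*-pos (*-pos p q) r))

  0≤-⇒0< : ∀ {x} → x ≉ 0# → 0# ≤ - x → 0# < - x
  0≤-⇒0< x≉0 (inj₁ p) = p
  0≤-⇒0< {x} x≉0 (inj₂ e) = contradiction (trans (sym (-‿involutive x))
    (trans (-‿cong (sym e)) -0#≈0#)) x≉0

  module _ {S : List ℝ²} {Δ : Triangle} (cell : IsCell S (region Δ)) where
    private
      v = corner Δ
      K = proj₁ cell
      component = proj₁ (proj₂ cell)
      region⊆closure = proj₁ (proj₂ (proj₂ cell))
      closure⊆region = proj₂ (proj₂ (proj₂ cell))

      K⊆region : K ⊆ region Δ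
      K⊆region {q} q∈K = closure⊆region (λ U _ q∈U → q , q∈U , q∈K)

      avoids : ∀ {s q} → s ∈ˢ S → q ∈ K → dot (covector s) (rep q) ≉ 0#
      avoids {s} {q} s∈S q∈K e =
        IsConnectedComponent.included component q∈K s s∈S (dot⇒⋆ s {q} e)

    -- If B * C > 0, then the line of p would have opposite signs (relative to that
    -- of c) near the vertices i and k of the cell, although it does not meet the cell.
    no-sign-change : ∀ {b c p D B C i k} → b ∈ˢ S → c ∈ˢ S → p ∈ˢ S → D ≉ 0# →
      D * dot (covector p) (v i) ≈ C * dot (covector c) (v i) → dot (covector c) (v i) ≉ 0# →
      D * dot (covector p) (v k) ≈ B * dot (covector b) (v k) → dot (covector b) (v k) ≉ 0# →
      (∀ {q} → q ∈ region Δ → 0# ≤ - (dot (covector b) (rep q) * dot (covector c) (rep q))) →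
      ¬ 0# < B * C
    no-sign-change {b} {c} {p} {D} {B} {C} {i} {k} b∈S c∈S p∈S D≉0 at-i ci≉0 at-k bk≉0 opposed BC>0 =
      constant-sign (IsConnectedComponent.connected component) P ((D * C) ·³ Lc)
        (λ {q} → avoids {p} {q} p∈S)
        (λ {q} q∈K e → *-≉0 (*-≉0 D≉0 C≉0) (avoids c∈S q∈K) (trans (sym (dot-scale (D * C) Lc (rep q))) e))
        {x} {y} x∈K y∈K x-pos y-neg
      where
      P = covector p
      Lb = covector b
      Lc = covector c
      B≉0 = *-≉0ˡ (0<⇒≉ BC>0)
      C≉0 = *-≉0ʳ (0<⇒≉ BC>0)

      vertex-sign : ∀ m E n → E ≉ 0# → dot m (v n) ≉ 0# → D * dot P (v n) ≈ E * dot m (v n) →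
        0# < dot P (v n) * dot ((D * E) ·³ m) (v n)
      vertex-sign m E n E≉0 m≉0 e = 0<-resp (*-congˡ (sym (dot-scale (D * E) m (v n))))
        (matching-sign E≉0 m≉0 e)

      -- The vertices belong only to the closure of `K`, so the strict signs found there are carried
      -- over to nearby points of `K`.
      near-i = region⊆closure {vertex Δ i} (TriangleProperties.vertex∈region Δ i) _
        (quadric-open P ((D * C) ·³ Lc)) (vertex-sign Lc C i C≉0 ci≉0 at-i)
      near-k = region⊆closure {vertex Δ k} (TriangleProperties.vertex∈region Δ k) _
        (quadric-open P ((D * B) ·³ Lb)) (vertex-sign Lb B k B≉0 bk≉0 at-k)
      x = proj₁ near-i
      x∈K = proj₂ (proj₂ near-i)
      x-pos = proj₁ (proj₂ near-i)
      y = proj₁ near-k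
      y∈K = proj₂ (proj₂ near-k)
      y-pos = proj₁ (proj₂ near-k)

      -- No form of a point of `S` vanishes on `K`, so the weak opposition on the closed triangle is
      -- strict here.
      bc-opposed : 0# < - (dot Lb (rep y) * dot Lc (rep y))
      bc-opposed = 0≤-⇒0< (*-≉0 (avoids {b} {y} b∈S y∈K) (avoids {c} {y} c∈S y∈K)) (opposed {y} (K⊆region {y} y∈K))

      y-neg : 0# < - (dot P (rep y) * dot ((D * C) ·³ Lc) (rep y))
      y-neg = 0<-resp (-‿cong (*-congˡ (sym (dot-scale (D * C) Lc (rep y)))))
        (opposite-sign (0<-resp (*-congˡ (dot-scale (D * B) Lb (rep y))) y-pos) bc-opposed BC>0)

    module _ {a b c} (D≉0 : orient a b c ≉ 0#) (a∈S : a ∈ˢ S) (b∈S : b ∈ˢ S) (c∈S : c ∈ˢ S)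
      {i j k} (i≢j : i ≢ j) (i≢k : i ≢ k) (j≢k : j ≢ k)
      (k⊆a : sideOpposite Δ k ⊆ a ⋆) (j⊆b : sideOpposite Δ j ⊆ b ⋆) (i⊆c : sideOpposite Δ i ⊆ c ⋆)
      (a-opposed : 0# < - (dot (covector a) (v k) * dot (covector c) (v i)))
      (b-opposed : 0# < - (dot (covector b) (v j) * dot (covector c) (v i))) where
      private
        module A = TriangleProperties.Side Δ {a} {k} (λ {q} → k⊆a {q})
        module B = TriangleProperties.Side Δ {b} {j} (λ {q} → j⊆b {q})
        module C = TriangleProperties.Side Δ {c} {i} (λ {q} → i⊆c {q})

        cone-opposed : ∀ {x y s t m} → 0# < - (x * y) → 0# ≤ s → 0# ≤ t →
          0# ≤ - (m * (s * x) * (m * (t * y)))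
        cone-opposed {x} {y} {s} {t} {m} neg 0≤s 0≤t = 0≤-resp
          (solve 5 (λ x y s t m → m :* m :* (s :* t) :* :- (x :* y) :=
            :- (m :* (s :* x) :* (m :* (t :* y)))) refl x y s t m)
          (*-nonneg (*-nonneg (sq-nonneg m) (*-nonneg 0≤s 0≤t)) (inj₁ neg))

        a-region-opposed : ∀ {q} → q ∈ region Δ → 0# ≤ - (dot A.l (rep q) * dot C.l (rep q))
        a-region-opposed {q} (s , 0≤s , (m , _ , e)) = 0≤-resp
          (-‿cong (sym (*-cong (A.opposite {rep q} {s} e) (C.opposite {rep q} {s} e))))
          (cone-opposed a-opposed (0≤s k) (0≤s i))

        b-region-opposed : ∀ {q} → q ∈ region Δ → 0# ≤ - (dot B.l (rep q) * dot C.l (rep q))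
        b-region-opposed {q} (s , 0≤s , (m , _ , e)) = 0≤-resp
          (-‿cong (sym (*-cong (B.opposite {rep q} {s} e) (C.opposite {rep q} {s} e))))
          (cone-opposed b-opposed (0≤s j) (0≤s i))

        zero-product : ∀ r {x} → x ≈ 0# → r * x ≈ 0#
        zero-product r e = trans (*-congˡ e) (zeroʳ r)

        j≢i : j ≢ i
        j≢i z = i≢j (≡.sym z)
        k≢i : k ≢ i
        k≢i z = i≢k (≡.sym z)
        k≢j : k ≢ j
        k≢j z = j≢k (≡.sym z)

        at-i : ∀ p → orient a b c * dot (covector p) (v i) ≈ orient a b p * dot C.l (v i)
        at-i p = trans (cramer a b c p (v i)) (trans (+-congʳ (trans
          (+-cong (zero-product _ (A.vanishes i i≢k)) (zero-product _ (B.vanishes i i≢j)))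
          (+-identityˡ 0#))) (+-identityˡ _))

        at-j : ∀ p → orient a b c * dot (covector p) (v j) ≈ orient a p c * dot B.l (v j)
        at-j p = trans (cramer a b c p (v j)) (trans
          (+-cong (+-congʳ (zero-product _ (A.vanishes j j≢k))) (zero-product _ (C.vanishes j j≢i)))
          (trans (+-identityʳ _) (+-identityˡ _)))

        at-k : ∀ p → orient a b c * dot (covector p) (v k) ≈ orient p b c * dot A.l (v k)
        at-k p = trans (cramer a b c p (v k)) (trans
          (+-cong (+-congˡ (zero-product _ (B.vanishes k k≢j))) (zero-product _ (C.vanishes k k≢i)))
          (trans (+-identityʳ _) (+-identityʳ _)))

      -- At each corner two of the three forms vanish and Cramer's rule keeps one term. Thus BC
      -- compares the values of `L_p` at the corners `i` and `j`, and AC those at `i` and `k`.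
      noSeparation : ∀ {p} → p ∈ˢ S → NoSeparation a b c p
      noSeparation {p} p∈S =
        no-sign-change {b} {c} {p} {i = i} {j} b∈S c∈S p∈S D≉0 (at-i p) C.nonvanishing
          (at-j p) B.nonvanishing (λ {q} → b-region-opposed {q}) ,
        no-sign-change {a} {c} {p} {i = i} {k} a∈S c∈S p∈S D≉0 (at-i p) C.nonvanishing
          (at-k p) A.nonvanishing (λ {q} → a-region-opposed {q})

-- Exit edges and triangular cells, in both directions.

module Equivalence (R : RealField) where
  open RealField R
  open Geometry R
  open OrderedField R
  open ℤ-Coefficients commutativeRing
  open Topology R
  open Cells R
  open Duality R
  open Direction R
  open TriangularCell R
  open ExitEdges R

  orient≉0 : ∀ {S} → GeneralPosition S → ∀ {a b c} → a ∈ˢ S → b ∈ˢ S → c ∈ˢ S →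
    a ≉² b → b ≉² c → a ≉² c → orient a b c ≉ 0#
  orient≉0 gp a∈S b∈S c∈S a≉b b≉c a≉c e =
    gp a∈S b∈S c∈S a≉b b≉c a≉c (orient-zero⇒collinear a≉b e)

  -- The sides meeting at the exit vertex lie on the dual lines of `a` and `b` in either order.
  -- Every other assignment puts two sides of the triangle on one line.
  triangle⇒exitEdge : ∀ S → GeneralPosition S →
    ∀ {a b c} → a ∈ˢ S → b ∈ˢ S → c ∈ˢ S → a ≉² b → b ≉² c → a ≉² c → ∀ Δ →
    IsCell S (region Δ) → IsBoundedBy Δ (a ⋆) (b ⋆) (c ⋆) → ¬ IsMarkedCell S (region Δ) →
    IsWitnessLine Δ (c ⋆) → ExitEdge S a b c
  triangle⇒exitEdge S gp {a} {b} {c} a∈S b∈S c∈S a≉b b≉c a≉c Δ cell bounded unmarked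
    (i , (j , k , i≢j , i≢k , j≢k , j→i , i→k) , i⊆c)
    with IsBoundedBy.sides bounded k | IsBoundedBy.sides bounded j
  ... | inj₁ k⊆a | inj₂ (inj₁ j⊆b) = noSeparation⇒exitEdge
      (noSeparation {S} {Δ} cell {a} {b} {c} (orient≉0 gp a∈S b∈S c∈S a≉b b≉c a≉c) a∈S b∈S c∈S
        i≢j i≢k j≢k (λ {q} → k⊆a {q}) (λ {q} → j⊆b {q}) (λ {q} → i⊆c {q}) O.opposed-e O.opposed-f)
    where
    module O = TriangleProperties.OpposedSides Δ i≢j i≢k j≢k {a} {b} {c}
      (λ {q} → k⊆a {q}) (λ {q} → j⊆b {q}) (λ {q} → i⊆c {q}) j→i i→k (λ m → unmarked (cell , m))
  ... | inj₂ (inj₁ k⊆b) | inj₁ j⊆a =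
    -- Exchanging `a` and `b` exchanges the two halves of the definition of an exit edge.
    let nb , na = noSeparation⇒exitEdge
          (noSeparation {S} {Δ} cell {b} {a} {c}
            (orient≉0 gp b∈S a∈S c∈S (λ e → a≉b (≈²-sym e)) a≉c b≉c) b∈S a∈S c∈S
            i≢j i≢k j≢k (λ {q} → k⊆b {q}) (λ {q} → j⊆a {q}) (λ {q} → i⊆c {q}) O.opposed-e O.opposed-f)
    in na , nb
    where
    module O = TriangleProperties.OpposedSides Δ i≢j i≢k j≢k {b} {a} {c}
      (λ {q} → k⊆b {q}) (λ {q} → j⊆a {q}) (λ {q} → i⊆c {q}) j→i i→k (λ m → unmarked (cell , m))
  ... | inj₁ k⊆a | inj₁ j⊆a =
    contradiction (λ {q} → k⊆a {q}) (TriangleProperties.sides-differ Δ {a} {j} {k} j≢k (λ {q} → j⊆a {q}))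
  ... | inj₂ (inj₁ k⊆b) | inj₂ (inj₁ j⊆b) =
    contradiction (λ {q} → k⊆b {q}) (TriangleProperties.sides-differ Δ {b} {j} {k} j≢k (λ {q} → j⊆b {q}))
  ... | inj₂ (inj₂ k⊆c) | _ =
    contradiction (λ {q} → k⊆c {q}) (TriangleProperties.sides-differ Δ {c} {i} {k} i≢k (λ {q} → i⊆c {q}))
  ... | _ | inj₂ (inj₂ j⊆c) =
    contradiction (λ {q} → j⊆c {q}) (TriangleProperties.sides-differ Δ {c} {i} {j} i≢j (λ {q} → i⊆c {q}))

  -- The middle coordinate of the identity (a × b) × (b × c) = det(a, b, c) b.
  turn-cross : ∀ a b c → turn (cross a b) (cross b c) ≈ det a b c * proj₁ (proj₂ b)
  turn-cross (a₁ , a₂ , a₃) (b₁ , b₂ , b₃) (c₁ , c₂ , c₃) =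
    solve 9 (λ a₁ a₂ a₃ b₁ b₂ b₃ c₁ c₂ c₃ →
      let a = a₁ , a₂ , a₃; b = b₁ , b₂ , b₃; c = c₁ , c₂ , c₃ in
      proj₁ (proj₂ (P.cross (P.cross a b) (P.cross b c))) := P.det a b c :* b₂)
      refl a₁ a₂ a₃ b₁ b₂ b₃ c₁ c₂ c₃

  turn-swap : ∀ u v → turn v u ≈ - turn u v
  turn-swap (a₁ , a₂ , a₃) (b₁ , b₂ , b₃) = solve 4 (λ a₁ a₃ b₁ b₃ →
    b₃ :* a₁ :- b₁ :* a₃ := :- (a₃ :* b₁ :- a₁ :* b₃)) refl a₁ a₃ b₁ b₃

  det-neg : ∀ a b c → det (-³ a) b c ≈ - det a b c
  det-neg (a₁ , a₂ , a₃) (b₁ , b₂ , b₃) (c₁ , c₂ , c₃) =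
    solve 9 (λ a₁ a₂ a₃ b₁ b₂ b₃ c₁ c₂ c₃ →
      let b = b₁ , b₂ , b₃; c = c₁ , c₂ , c₃ in
      P.det (:- a₁ , :- a₂ , :- a₃) b c := :- P.det (a₁ , a₂ , a₃) b c)
      refl a₁ a₂ a₃ b₁ b₂ b₃ c₁ c₂ c₃

  -- Multiplying the sum by -C s gives -AC (s x) - BC (s y) + C² s², where the first two terms are
  -- nonnegative and the last is positive.
  same-sign-sum≉0 : ∀ {A B C x y z s} → s ≈ - z → 0# < s * x → 0# < s * y → C ≉ 0# →
    ¬ 0# < B * C → ¬ 0# < A * C → A * x + B * y + C * z ≉ 0#
  same-sign-sum≉0 {A} {B} {C} {x} {y} {z} {s} s≈-z 0<sx 0<sy C≉0 nB nA sum≈0 = 0<⇒≉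
    (+-nonneg-pos (+-nonneg (*-nonneg (¬0<⇒0≤- nA) (inj₁ 0<sx)) (*-nonneg (¬0<⇒0≤- nB) (inj₁ 0<sy)))
                  (*-pos (sq-pos C≉0) (sq-pos (*-≉0ˡ (0<⇒≉ 0<sx)))))
    (trans
      (solve 7 (λ A B C x y z s →
        :- (A :* C) :* (s :* x) :+ :- (B :* C) :* (s :* y) :+ C :* C :* (s :* s) :=
        :- (C :* s) :* (A :* x :+ B :* y :+ C :* z) :+ C :* C :* s :* (s :+ z)) refl A B C x y z s)
      (trans (+-cong (trans (*-congˡ sum≈0) (zeroʳ _))
                     (trans (*-congˡ (trans (+-congʳ s≈-z) (-‿inverseˡ z))) (zeroʳ _)))
             (+-identityˡ 0#)))

  -- The triangle dual to an exit edge.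

  module ExitTriangle (a b c : ℝ²) (D≉0 : orient a b c ≉ 0#) where
    La = covector a
    Lb = covector b
    Lc = covector c

    -- Negating the form of `c` selects the triangle on which `La` and `Lb` agree in sign and `Lc`
    -- is opposed to them.
    l : Fin 3 → ℝ³
    l 0F = -³ Lc
    l 1F = La
    l 2F = Lb

    neg-≉0 : ∀ {x} → x ≉ 0# → - x ≉ 0#
    neg-≉0 {x} x≉0 e = x≉0 (trans (sym (-‿involutive x))
      (trans (-‿cong e) -0#≈0#))

    det≉0 : det (l 0F) (l 1F) (l 2F) ≉ 0#
    det≉0 e = neg-≉0 D≉0 (trans (sym (trans (det-neg Lc La Lb) (-‿cong (sym (det-cycle Lc La Lb))))) e)

    open DualTriangle l det≉0 public

    side⊆ : ∀ i p → (∀ {q} → dot (l i) q ≈ 0# → dot (covector p) q ≈ 0#) →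
            sideOpposite triangle i ⊆ p ⋆
    side⊆ i p f {q} (s , _ , si≈0 , (k , _ , e)) = dot⇒⋆ p {q} (f
      (trans (side-∼ {rep q} {s} e i) (trans (*-congˡ si≈0) (zeroʳ _))))

    side-c : ∀ {q} → dot (l 0F) q ≈ 0# → dot Lc q ≈ 0#
    side-c {q} e = trans (sym (-‿involutive (dot Lc q)))
      (trans (-‿cong (trans (sym (dot-neg Lc q)) e)) -0#≈0#)

    0⊆c : sideOpposite triangle 0F ⊆ c ⋆
    0⊆c {q} = side⊆ 0F c side-c {q}
    1⊆a : sideOpposite triangle 1F ⊆ a ⋆
    1⊆a {q} = side⊆ 1F a (λ e → e) {q}
    2⊆b : sideOpposite triangle 2F ⊆ b ⋆
    2⊆b {q} = side⊆ 2F b (λ e → e) {q}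

    bounded : IsBoundedBy triangle (a ⋆) (b ⋆) (c ⋆)
    bounded = record
      { side₁ = 1F , λ {q} → 1⊆a {q}
      ; side₂ = 2F , λ {q} → 2⊆b {q}
      ; side₃ = 0F , λ {q} → 0⊆c {q}
      ; sides = λ { 0F → inj₂ (inj₂ λ {q} → 0⊆c {q})
                  ; 1F → inj₁ λ {q} → 1⊆a {q}
                  ; 2F → inj₂ (inj₁ λ {q} → 2⊆b {q}) }
      }

    -- At the vertical point the forms `- Lc` and `La` have the values -1 and 1.
    vertical∉region : ¬ region triangle verticalInfinity
    vertical∉region r = 0≤-⇒¬0< (0≤-resp
      (trans (*-cong (trans (dot-neg Lc vertical) (-‿cong (covector-vertical c))) (covector-vertical a))
             (*-identityʳ _))
      (region-side {verticalInfinity} r 0F 1F)) 0<1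

    -- The sides meeting at corner `0F` lie on the lines of `a` and `b`, whose covectors have middle
    -- coordinate 1. Hence both turns equal `D`, and its sign only decides which way the directed
    -- path runs through that corner.
    turn₀₁ : turn (corners 0F) (corners 1F) ≈ D
    turn₀₁ = trans (turn-cross (l 1F) (l 2F) (l 0F))
      (trans (*-identityʳ _) (det-cycle (l 0F) (l 1F) (l 2F)))

    turn₂₀ : turn (corners 2F) (corners 0F) ≈ D
    turn₂₀ = trans (turn-cross (l 0F) (l 1F) (l 2F)) (*-identityʳ _)

    exitVertex : IsExitVertex triangle 0F
    exitVertex = orientation (sign D)
      where
      orientation : Sign D → IsExitVertex triangle 0F
      orientation (positive p) = 2F , 1F , (λ ()) , (λ ()) , (λ ()) ,
        turn⇒directed (corners 2F) (corners 0F) (0<-resp (sym turn₂₀) p) ,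
        turn⇒directed (corners 0F) (corners 1F) (0<-resp (sym turn₀₁) p)
      orientation (null e) = contradiction e det≉0
      orientation (negative n) = 1F , 2F , (λ ()) , (λ ()) , (λ ()) ,
        turn⇒directed (corners 1F) (corners 0F)
          (0<-resp (sym (trans (turn-swap (corners 0F) (corners 1F)) (-‿cong turn₀₁))) n) ,
        turn⇒directed (corners 0F) (corners 2F)
          (0<-resp (sym (trans (turn-swap (corners 2F) (corners 0F)) (-‿cong turn₂₀))) n)

    exitPoint : IsExitPoint triangle (a ⋆ ∩ b ⋆)
    exitPoint = 0F , exitVertex , (λ {q} → to q) , λ {q} → from q
      where
      to : ∀ q → q ∈ a ⋆ ∩ b ⋆ → q ≈ᴾ vertex triangle 0F
      to q (q∈a , q∈b) = ·³-cancel′ (decompose (rep q))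
        where
        s = side (rep q)
        s₁≈0 : s 1F ≈ 0#
        s₁≈0 = ⋆⇒dot a {q} q∈a
        s₂≈0 : s 2F ≈ 0#
        s₂≈0 = ⋆⇒dot b {q} q∈b
        s₀≉0 : s 0F ≉ 0#
        s₀≉0 e = nonzero q (side-zero (rep q) λ { 0F → e ; 1F → s₁≈0 ; 2F → s₂≈0 })

        only-first : ∀ {x y z} → s 0F * x + s 1F * y + s 2F * z ≈ s 0F * x
        only-first = trans (+-cong (trans (+-congˡ (trans (*-congʳ s₁≈0) (zeroˡ _))) (+-identityʳ _))
          (trans (*-congʳ s₂≈0) (zeroˡ _))) (+-identityʳ _)

        ·³-cancel′ : D ·³ rep q ≈³ combination s corners → rep q ∼ corners 0F
        ·³-cancel′ e = ∼-trans {rep q} {s 0F ·³ corners 0F} {corners 0F}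
          (·³-cancel det≉0 (≈³-trans e (only-first , only-first , only-first)))
          (s 0F , s₀≉0 , ≈³-refl)

      from : ∀ q → q ≈ᴾ vertex triangle 0F → q ∈ a ⋆ ∩ b ⋆
      from q (k , _ , e) =
        dot⇒⋆ a {q} (vanishes La (dot-crossˡ La Lb)) , dot⇒⋆ b {q} (vanishes Lb (dot-crossʳ La Lb))
        where
        vanishes : ∀ m → dot m (corners 0F) ≈ 0# → dot m (rep q) ≈ 0#
        vanishes m z = trans (dot-cong {m} {m} {rep q} ≈³-refl e)
          (trans (dot-· m k (corners 0F)) (trans (*-congˡ z) (zeroʳ k)))

    avoids-separating : ∀ q p → q ∈ Interior → orient a b p ≉ 0# → NoSeparation a b c p →
      dot (covector p) (rep q) ≉ 0#
    avoids-separating q p q∈I C≉0 (nB , nA) P≈0 =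
      same-sign-sum≉0 (dot-neg Lc (rep q)) (proj₁ q∈I) (proj₂ q∈I) C≉0 nB nA
        (trans (sym (cramer a b c p (rep q))) (trans (*-congˡ P≈0) (zeroʳ _)))

  exitEdge⇒triangle : ∀ S → GeneralPosition S →
    ∀ {a b c} → a ∈ˢ S → b ∈ˢ S → c ∈ˢ S → a ≉² b → b ≉² c → a ≉² c → ExitEdge S a b c →
    ∃[ Δ ] IsCell S (region Δ) × IsBoundedBy Δ (a ⋆) (b ⋆) (c ⋆) × (¬ IsMarkedCell S (region Δ))
         × IsWitnessLine Δ (c ⋆) × IsExitPoint Δ (a ⋆ ∩ b ⋆)
  exitEdge⇒triangle S gp {a} {b} {c} a∈S b∈S c∈S a≉b b≉c a≉c exit =
    T.triangle , T.isCell {S} (λ {q} → interior⊆ {q}) (λ {q} → sides≉0 {q}) , T.bounded ,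
    (λ m → T.vertical∉region (proj₂ m)) ,
    (0F , T.exitVertex , λ {q} → T.0⊆c {q}) , T.exitPoint
    where
    module T = ExitTriangle a b c (orient≉0 gp a∈S b∈S c∈S a≉b b≉c a≉c)

    interior⊆ : ∀ {q} → q ∈ T.Interior → q ∈ Complement S
    interior⊆ {q} q∈I p p∈S q∈p = off (⋆⇒dot p {q} q∈p)
      where
      equal : ∀ {s} → p ≈² s → dot (covector s) (rep q) ≉ 0# → dot (covector p) (rep q) ≉ 0#
      equal {s} e s≉0 z = s≉0 (trans
        (dot-cong {covector s} {covector p} {rep q} (covector-cong (≈²-sym e)) ≈³-refl) z)

      off : dot (covector p) (rep q) ≉ 0#
      -- The forms of `a` and `b` are sides of the triangle. For every other point, `c` included,
      -- general position makes `orient a b p` nonzero and the absence of separations applies.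
      off with p ≈²? a | p ≈²? b
      ... | yes p≈a | _       = equal p≈a (*-≉0ʳ (0<⇒≉ (proj₁ q∈I)))
      ... | no _    | yes p≈b = equal p≈b (*-≉0ʳ (0<⇒≉ (proj₂ q∈I)))
      ... | no p≉a  | no p≉b  = T.avoids-separating q p q∈I
        (orient≉0 gp a∈S b∈S p∈S a≉b (λ e → p≉b (≈²-sym e)) (λ e → p≉a (≈²-sym e)))
        (exitEdge⇒noSeparation exit p∈S)

    sides≉0 : ∀ {q} → q ∈ Complement S → ∀ i → T.side (rep q) i ≉ 0#
    sides≉0 {q} q∈X 0F e = q∈X c c∈S (dot⇒⋆ c {q} (T.side-c e))
    sides≉0 {q} q∈X 1F e = q∈X a a∈S (dot⇒⋆ a {q} e)
    sides≉0 {q} q∈X 2F e = q∈X b b∈S (dot⇒⋆ b {q} e)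

theorem3 : (R : RealField) → let open Geometry R in
    (S : List ℝ²) → GeneralPosition S →
    ∀ a b c → a ∈ˢ S → b ∈ˢ S → c ∈ˢ S → a ≉² b → b ≉² c → a ≉² c →
    ExitEdge S a b c ⇔
    (∃[ Δ ] IsCell S (region Δ)
    × IsBoundedBy Δ (a ⋆) (b ⋆) (c ⋆)
    × (¬ IsMarkedCell S (region Δ))
    × IsWitnessLine Δ (c ⋆)
    × IsExitPoint Δ (a ⋆ ∩ b ⋆))
theorem3 R S gp a b c a∈S b∈S c∈S a≉b b≉c a≉c = mk⇔
  (exitEdge⇒triangle S gp a∈S b∈S c∈S a≉b b≉c a≉c)
  (λ (Δ , cell , bounded , unmarked , witness , _) →
    triangle⇒exitEdge S gp a∈S b∈S c∈S a≉b b≉c a≉c Δ cell bounded unmarked witness)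
  where
  open Equivalence R
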